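{- Let $m,\ell\geq 1$ be integers. Each of the following symmetric matrices with zero diagonal and entries in $\{0,\pm1\}$ is the adjacency matrix of a signed graph having all but at most two eigenvalues equal to $\pm1$; more precisely they have the stated spectra (multiplicities as exponents): \begin{enumerate} \item $A_1=\begin{bmatrix} J-I_m & J\\ J & -R_{2\ell}\end{bmatrix}$ (block sizes $m,2\ell$), with spectrum $\{ -1^{\ell+m-2},1^{\ell},\tfrac12(m-2\pm\sqrt{m(m+8\ell)})\}$; \item $A_2=\begin{bmatrix} R_{2m} & J\\ J & -R_{2\ell}\end{bmatrix}$ (block sizes $2m,2\ell$), with spectrum $\{ -1^{m+\ell-1},1^{m+\ell-1},\pm\sqrt{1+4m\ell}\}$; \item $A_3=\begin{bmatrix} J-I_m & \mathbf{1} & \mathbf{1} & O\\ \mathbf{1}^\top & 0 & 1 & -\mathbf{1}^\top\\ \mathbf{1}^\top & 1 & 0 & \mathbf{1}^\top\\ O & -\mathbf{1} & \mathbf{1} & I_\ell-J\end{bmatrix}$ (block sizes $m,1,1,\ell$), with spectrum $\{ -1^{m},1^{\ell},-\ell-1,m+1\}$; \item $A_4=\begin{bmatrix} J-I_m & J & O & J\\ J & R_2 & O & O\\ O & O & -R_2 & -J\\ J & O & -J & I_\ell-J\end{bmatrix}$ (block sizes $m,2,2,\ell$), with spectrum $\{ -1^{m+1},1^{\ell+1},\tfrac12(m-\ell\pm\sqrt{m^2+\ell^2+6m\ell+4m+4\ell+4})\}$. \end{enumerate}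
   Context: $J$ denotes an all-ones matrix, $O$ an all-zeros matrix, $\mathbf{1}$ an all-ones column vector, of sizes determined by the block structure; $I_k$ is the $k\times k$ identity. $R_k$ is the $k\times k$ reverse identity matrix: $R_k(i,j)=1$ if $i+j=k+1$ and $0$ otherwise. A signed graph is a finite simple graph with a signature $\sigma:E\to\{ -1,+1\}$; its adjacency matrix has entry $\sigma(\{u,v\})$ for edges and $0$ otherwise. -}

module Defs where

open import Level using (Level)
open import Function using (_∘_)
open import Data.Nat as ℕ using (ℕ; zero; suc; _∸_)
open import Data.Fin using (Fin; toℕ; splitAt; punchIn) renaming (zero to fzero; suc to fsuc)
open import Data.Fin.Properties using () renaming (_≟_ to _≟F_)
open import Data.Sum using (inj₁; inj₂)
open import Data.Integer as ℤ using (ℤ; +_; -[1+_])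
open import Data.List using (List; []; _∷_; _++_; replicate; map; foldr)
open import Data.Product using (_×_; _,_)
open import Data.Sum using (_⊎_)
open import Relation.Nullary using (yes; no)
open import Relation.Binary.PropositionalEquality using (_≡_)
open import Algebra.Bundles using (CommutativeRing)

Block : ℕ → ℕ → Set
Block p q = Fin p → Fin q → ℤ

Matrix : ℕ → Set
Matrix n = Block n n

-- all-ones J and all-zeros O (of any shape; 𝟏 is J with one column/row)
J : ∀ {p q} → Block p q
J _ _ = + 1

O : ∀ {p q} → Block p q
O _ _ = + 0

I : (k : ℕ) → Matrix k
I k i j with i ≟F j
... | yes _ = + 1
... | no  _ = + 0

-- reverse identity R_k : R_k(i,j) = 1 iff i + j = k + 1 (1-based),
-- i.e. toℕ i + toℕ j + 1 = k with 0-based indices.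
Rev : (k : ℕ) → Matrix k
Rev k i j with suc (toℕ i ℕ.+ toℕ j) ℕ.≟ k
... | yes _ = + 1
... | no  _ = + 0

_⊕_ : ∀ {p q} → Block p q → Block p q → Block p q
(A ⊕ B) i j = A i j ℤ.+ B i j

⊖_ : ∀ {p q} → Block p q → Block p q
(⊖ A) i j = ℤ.- A i j

_⊝_ : ∀ {p q} → Block p q → Block p q → Block p q
A ⊝ B = A ⊕ (⊖ B)

block2 : ∀ {a b} → Block a a → Block a b → Block b a → Block b b → Matrix (a ℕ.+ b)
block2 {a} A B C D i j with splitAt a i | splitAt a j
... | inj₁ i' | inj₁ j' = A i' j'
... | inj₁ i' | inj₂ j' = B i' j'
... | inj₂ i' | inj₁ j' = C i' j'
... | inj₂ i' | inj₂ j' = D i' j'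

row4 : ∀ {p} a b c d → Block p a → Block p b → Block p c → Block p d
     → Block p (a ℕ.+ (b ℕ.+ (c ℕ.+ d)))
row4 a b c d X₁ X₂ X₃ X₄ i j with splitAt a j
... | inj₁ j₁ = X₁ i j₁
... | inj₂ j' with splitAt b j'
...   | inj₁ j₂ = X₂ i j₂
...   | inj₂ j'' with splitAt c j''
...     | inj₁ j₃ = X₃ i j₃
...     | inj₂ j₄ = X₄ i j₄

block4 : ∀ a b c d → let n = a ℕ.+ (b ℕ.+ (c ℕ.+ d)) in
         Block a n → Block b n → Block c n → Block d n → Matrix n
block4 a b c d R₁ R₂ R₃ R₄ i j with splitAt a i
... | inj₁ i₁ = R₁ i₁ j
... | inj₂ i' with splitAt b i'
...   | inj₁ i₂ = R₂ i₂ j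
...   | inj₂ i'' with splitAt c i''
...     | inj₁ i₃ = R₃ i₃ j
...     | inj₂ i₄ = R₄ i₄ j

_ᵀ : ∀ {p q} → Block p q → Block q p
(A ᵀ) i j = A j i

IsSignedAdjacency : ∀ {n} → Matrix n → Set
IsSignedAdjacency {n} A =
  ((i j : Fin n) → A i j ≡ A j i) ×
  ((i : Fin n) → A i i ≡ + 0) ×
  ((i j : Fin n) → (A i j ≡ + 0) ⊎ ((A i j ≡ + 1) ⊎ (A i j ≡ -[1+ 0 ])))

A₁ : (m ℓ : ℕ) → Matrix (m ℕ.+ 2 ℕ.* ℓ)
A₁ m ℓ = block2 (J ⊝ I m) J J (⊖ Rev (2 ℕ.* ℓ))

A₂ : (m ℓ : ℕ) → Matrix (2 ℕ.* m ℕ.+ 2 ℕ.* ℓ)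
A₂ m ℓ = block2 (Rev (2 ℕ.* m)) J J (⊖ Rev (2 ℕ.* ℓ))

A₃ : (m ℓ : ℕ) → Matrix (m ℕ.+ (1 ℕ.+ (1 ℕ.+ ℓ)))
A₃ m ℓ = block4 m 1 1 ℓ
  (row4 m 1 1 ℓ (J ⊝ I m) J     J   O)
  (row4 m 1 1 ℓ J         O     J   (⊖ J))
  (row4 m 1 1 ℓ J         J     O   J)
  (row4 m 1 1 ℓ O         (⊖ J) J   (I ℓ ⊝ J))

A₄ : (m ℓ : ℕ) → Matrix (m ℕ.+ (2 ℕ.+ (2 ℕ.+ ℓ)))
A₄ m ℓ = block4 m 2 2 ℓ
  (row4 m 2 2 ℓ (J ⊝ I m) J       O           J)
  (row4 m 2 2 ℓ J         (Rev 2) O           O)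
  (row4 m 2 2 ℓ O         O       (⊖ Rev 2)   (⊖ J))
  (row4 m 2 2 ℓ J         O       (⊖ J)       (I ℓ ⊝ J))

module _ {c r : Level} (R : CommutativeRing c r) where
  open CommutativeRing R

  fromℕ : ℕ → Carrier
  fromℕ zero    = 0#
  fromℕ (suc n) = 1# + fromℕ n

  fromℤ : ℤ → Carrier
  fromℤ (+ n)      = fromℕ n
  fromℤ -[1+ n ]   = - fromℕ (suc n)

  sumFin : ∀ {n} → (Fin n → Carrier) → Carrier
  sumFin {zero}  f = 0#
  sumFin {suc n} f = f fzero + sumFin (f ∘ fsuc)

  altSign : ℕ → Carrier
  altSign zero    = 1#
  altSign (suc k) = - altSign k

  det : ∀ {n} → (Fin n → Fin n → Carrier) → Carrier
  det {zero}  M = 1#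
  det {suc n} M =
    sumFin (λ j → altSign (toℕ j) * (M fzero j * det (λ i k → M (fsuc i) (punchIn j k))))

  charPolyAt : ∀ {n} → Matrix n → Carrier → Carrier
  charPolyAt {n} A t = det (λ i j → diag i j - fromℤ (A i j))
    where
    diag : Fin n → Fin n → Carrier
    diag i j with i ≟F j
    ... | yes _ = t
    ... | no  _ = 0#

  HasSpectrum : ∀ {n} → Matrix n → List Carrier → Set (c Level.⊔ r)
  HasSpectrum A λs =
    (t : Carrier) → charPolyAt A t ≈ foldr _*_ 1# (map (λ μ → t - μ) λs)

  _^^_ : Carrier → ℕ → List Carrier
  x ^^ k = replicate k x

{-# OPTIONS --safe #-}
module Submission where

-- In t I − A the columns of two twin vertices x, y differ by d (eₓ − e_y) for a
-- scalar d. Subtracting column y from column x and then adding row x to row y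
-- splits off the factor d and deletes x, the row of y now carrying the weight of
-- both vertices. Merging all twins leaves the determinant of the quotient
-- matrix, of order 2 for A₁ and A₂ and of order 4 for A₃ and A₄, whose
-- factorisation is a polynomial identity. In the blocks ± R₂ₖ the two vertices of
-- each mirror pair are merged first (d = t ± 1); the k merged vertices are
-- then themselves twins (d = t ∓ 1).

open import Defs
open import Level using (_⊔_)
open import Function.Base using (_∘_; id; const; flip)
open import Function.Bundles using (_↔_; Inverse; mk↔ₛ′)
open import Function.Properties.Inverse using (↔-refl; ↔-sym; ↔-trans)
open import Data.Bool.Base using (if_then_else_)
open import Data.Nat as ℕ using (ℕ; zero; suc; _≤_; _∸_)
import Data.Nat.Properties as ℕₚ
open import Data.Fin.Base using (Fin; zero; suc; toℕ; splitAt; punchIn; punchOut; lift; opposite; _↑ˡ_; _↑ʳ_)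
import Data.Fin.Properties as Finₚ
open import Data.Fin.Permutation using (↔⇒≡)
open import Data.Integer.Base as ℤ using (ℤ; +_; -[1+_])
import Data.Integer.Properties as ℤₚ
open import Data.Sign.Base as Sign using (Sign)
import Data.Maybe.Base as Maybe
open import Data.Product.Base using (_×_; _,_)
open import Data.Sum.Base as Sum using (_⊎_; inj₁; inj₂; [_,_]; map₁)
import Data.Sum.Properties as Sumₚ
open import Data.Sum.Algebra using (⊎-cong; ⊎-comm)
open import Data.Vec.Base using (Vec; []; _∷_; lookup)
open import Data.List.Base as List using (List; []; _∷_; _++_)
open import Relation.Nullary using (Dec; yes; no; does; contradiction)
open import Relation.Nullary.Decidable using (_⊎-dec_; dec⇒maybe; from-yes)
open import Relation.Binary.Definitions using (DecidableEquality)
open import Relation.Binary.PropositionalEquality as ≡ using (_≡_; _≢_; _≗_)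
open import Algebra.Bundles using (CommutativeMonoid; CommutativeRing)
open import Algebra.Solver.Ring.AlmostCommutativeRing using (fromCommutativeRing; _-Raw-AlmostCommutative⟶_)
import Algebra.Solver.Ring

-- The ring is an arbitrary commutative one, without division, so the spectrum is obtained as a
-- factorisation of the determinant at every `t` and not from eigenvectors. One half and the square
-- roots enter as elements `h` and `s` constrained only by `h + h ≈ 1#` and by the value of `s * s`.
-- Twins are recognised by their columns alone. A merge adds rows but never columns, so the matrix
-- stops being symmetric, while the column condition survives for the vertices still to be merged;
-- this is what makes an induction over all of them possible. Mirror pairs have to be merged before
-- anything else in a block `± R`: vertices of two different pairs are not twins, since each sees
-- its own partner. Once every pair is one vertex, the block is a scalar matrix. The determinant is
-- defined on `Fin n` by expansion along row 0, whereas a merge should apply to any vertex of any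
-- block. Hence index sets are disjoint unions, and the determinant must be shown not to depend on
-- how they are enumerated; the signs of permutations are developed for this purpose.

-- Ring solver with integer coefficients.

module IntegerSolver {c r} (R : CommutativeRing c r) where
  open CommutativeRing R hiding (zero)
  open import Algebra.Properties.Ring ring using (-0#≈0#; -‿involutive; -1*x≈-x)
  open import Algebra.Properties.AbelianGroup +-abelianGroup using (⁻¹-∙-comm)
  open import Algebra.Properties.Semiring.Mult.TCOptimised semiring using (1+×; ×-homo-+; ×1-homo-*; ×ᵤ≈×) renaming (_×_ to _×′_)
  open import Algebra.Properties.Semiring.Mult semiring using () renaming (_×_ to _×ᵤ_)
  open import Relation.Binary.Reasoning.Setoid setoid

  -- Unlike fromℤ, this satisfies ι (+ 1) = 1# definitionally, so that the
  -- solver's numerals match the ring constants on the nose.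
  ιℕ : ℕ → Carrier
  ιℕ n = n ×′ 1#

  ι : ℤ → Carrier
  ι (+ n)    = ιℕ n
  ι -[1+ n ] = - ιℕ (suc n)

  ι-⊖ : ∀ m n → ι (m ℤ.⊖ n) ≈ ιℕ m - ιℕ n
  ι-⊖ zero    zero    = sym (-‿inverseʳ 0#)
  ι-⊖ zero    (suc n) = sym (+-identityˡ _)
  ι-⊖ (suc m) zero    = sym (trans (+-congˡ -0#≈0#) (+-identityʳ _))
  ι-⊖ (suc m) (suc n) = begin
    ι (suc m ℤ.⊖ suc n)               ≡⟨ ≡.cong ι (ℤₚ.[1+m]⊖[1+n]≡m⊖n m n) ⟩
    ι (m ℤ.⊖ n)                       ≈⟨ ι-⊖ m n ⟩
    ιℕ m - ιℕ n                       ≈⟨ +-congʳ (+-identityʳ _) ⟨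
    ιℕ m + 0# - ιℕ n                  ≈⟨ +-congʳ (+-congˡ (-‿inverseʳ 1#)) ⟨
    ιℕ m + (1# - 1#) - ιℕ n           ≈⟨ +-congʳ (+-assoc _ _ _) ⟨
    ιℕ m + 1# - 1# - ιℕ n             ≈⟨ +-assoc _ _ _ ⟩
    ιℕ m + 1# + (- 1# - ιℕ n)         ≈⟨ +-cong (+-comm _ _) (⁻¹-∙-comm _ _) ⟩
    1# + ιℕ m - (1# + ιℕ n)           ≈⟨ +-cong (1+× m 1#) (-‿cong (1+× n 1#)) ⟨
    ιℕ (suc m) - ιℕ (suc n)           ∎

  ι-+ : ∀ i j → ι (i ℤ.+ j) ≈ ι i + ι j
  ι-+ (+ m)    (+ n)    = ×-homo-+ 1# m n
  ι-+ (+ m)    -[1+ n ] = ι-⊖ m (suc n)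
  ι-+ -[1+ m ] (+ n)    = trans (ι-⊖ n (suc m)) (+-comm _ _)
  ι-+ -[1+ m ] -[1+ n ] = begin
    - ιℕ (suc (suc (m ℕ.+ n)))     ≡⟨ ≡.cong (λ k → - ιℕ (suc k)) (ℕₚ.+-suc m n) ⟨
    - ιℕ (suc m ℕ.+ suc n)         ≈⟨ -‿cong (×-homo-+ 1# (suc m) (suc n)) ⟩
    - (ιℕ (suc m) + ιℕ (suc n))    ≈⟨ ⁻¹-∙-comm _ _ ⟨
    - ιℕ (suc m) - ιℕ (suc n)      ∎

  ι-neg : ∀ i → ι (ℤ.- i) ≈ - ι i
  ι-neg (+ zero)  = sym -0#≈0#
  ι-neg (+ suc n) = refl
  ι-neg -[1+ n ]  = sym (-‿involutive _)

  ιS : Sign → Carrier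
  ιS Sign.+ = 1#
  ιS Sign.- = - 1#

  ι-◃ : ∀ s n → ι (s ℤ.◃ n) ≈ ιS s * ιℕ n
  ι-◃ s      zero    = sym (zeroʳ (ιS s))
  ι-◃ Sign.+ (suc n) = sym (*-identityˡ _)
  ι-◃ Sign.- (suc n) = sym (-1*x≈-x _)

  ιS-* : ∀ s t → ιS (s Sign.* t) ≈ ιS s * ιS t
  ιS-* Sign.+ t      = sym (*-identityˡ _)
  ιS-* Sign.- Sign.+ = sym (*-identityʳ _)
  ιS-* Sign.- Sign.- = sym (trans (-1*x≈-x _) (-‿involutive _))

  ι-sign : ∀ i → ι i ≈ ιS (ℤ.sign i) * ιℕ ℤ.∣ i ∣
  ι-sign (+ n)    = sym (*-identityˡ _)
  ι-sign -[1+ n ] = sym (-1*x≈-x _)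

  -- Integer multiplication is defined by multiplying signs and absolute values separately, so both
  -- arguments are split in this way and the four factors are regrouped.
  ι-* : ∀ i j → ι (i ℤ.* j) ≈ ι i * ι j
  ι-* i j = begin
    ι (s Sign.* t ℤ.◃ a ℕ.* b)             ≈⟨ ι-◃ (s Sign.* t) (a ℕ.* b) ⟩
    ιS (s Sign.* t) * ιℕ (a ℕ.* b)         ≈⟨ *-cong (ιS-* s t) (×1-homo-* a b) ⟩
    (ιS s * ιS t) * (ιℕ a * ιℕ b)          ≈⟨ *-assoc _ _ _ ⟩
    ιS s * (ιS t * (ιℕ a * ιℕ b))          ≈⟨ *-congˡ (*-assoc _ _ _) ⟨
    ιS s * (ιS t * ιℕ a * ιℕ b)            ≈⟨ *-congˡ (*-congʳ (*-comm _ _)) ⟩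
    ιS s * (ιℕ a * ιS t * ιℕ b)            ≈⟨ *-congˡ (*-assoc _ _ _) ⟩
    ιS s * (ιℕ a * (ιS t * ιℕ b))          ≈⟨ *-assoc _ _ _ ⟨
    (ιS s * ιℕ a) * (ιS t * ιℕ b)          ≈⟨ *-cong (ι-sign i) (ι-sign j) ⟨
    ι i * ι j                              ∎
    where
    s = ℤ.sign i; t = ℤ.sign j; a = ℤ.∣ i ∣; b = ℤ.∣ j ∣

  ι-homomorphism : ℤ.+-*-rawRing -Raw-AlmostCommutative⟶ fromCommutativeRing R
  ι-homomorphism = record
    { ⟦_⟧ = ι ; +-homo = ι-+ ; *-homo = ι-* ; -‿homo = ι-neg ; 0-homo = refl ; 1-homo = refl }

  open Algebra.Solver.Ring ℤ.+-*-rawRing (fromCommutativeRing R) ι-homomorphism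
    (λ i j → Maybe.map (reflexive ∘ ≡.cong ι) (dec⇒maybe (i ℤₚ.≟ j))) public
    using (Polynomial; solve; _:=_; _:+_; _:*_; :-_; _:-_; con)

  -- `fromℕ R n` unfolds to the plain multiple `n ×ᵤ 1#`. Passing to `ιℕ` gives access to the laws
  -- by which multiples of `1#` respect sums and products.
  fromℕ≈ι : ∀ n → fromℕ R n ≈ ιℕ n
  fromℕ≈ι n = trans (reflexive (fromℕ≡× n)) (×ᵤ≈× n 1#)
    where
    fromℕ≡× : ∀ n → fromℕ R n ≡ n ×ᵤ 1#
    fromℕ≡× zero    = ≡.refl
    fromℕ≡× (suc n) = ≡.cong (λ x → 1# + x) (fromℕ≡× n)

  fromℕ-+ : ∀ m n → fromℕ R (m ℕ.+ n) ≈ fromℕ R m + fromℕ R n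
  fromℕ-+ m n = begin
    fromℕ R (m ℕ.+ n)      ≈⟨ fromℕ≈ι (m ℕ.+ n) ⟩
    ιℕ (m ℕ.+ n)           ≈⟨ ×-homo-+ 1# m n ⟩
    ιℕ m + ιℕ n            ≈⟨ +-cong (fromℕ≈ι m) (fromℕ≈ι n) ⟨
    fromℕ R m + fromℕ R n  ∎

  fromℕ-* : ∀ m n → fromℕ R (m ℕ.* n) ≈ fromℕ R m * fromℕ R n
  fromℕ-* m n = begin
    fromℕ R (m ℕ.* n)      ≈⟨ fromℕ≈ι (m ℕ.* n) ⟩
    ιℕ (m ℕ.* n)           ≈⟨ ×1-homo-* m n ⟩
    ιℕ m * ιℕ n            ≈⟨ *-cong (fromℕ≈ι m) (fromℕ≈ι n) ⟨
    fromℕ R m * fromℕ R n  ∎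

-- Determinants: expansion, transposition and alternation.

module Determinant {c r} (R : CommutativeRing c r) where
  open CommutativeRing R hiding (zero)
  open IntegerSolver R
  open import Algebra.Properties.Ring ring using (-1*x≈-x)
  open import Algebra.Properties.Semiring.Sum semiring using (sum; ∑-distrib-+; ∑-comm; *-distribˡ-sum)
  open import Relation.Binary.Reasoning.Setoid setoid

  Mat : ℕ → Set c
  Mat n = Fin n → Fin n → Carrier

  private variable n : ℕ

  sumFin≡sum : ∀ (f : Fin n → Carrier) → sumFin R f ≡ sum f
  sumFin≡sum {zero}  f = ≡.refl
  sumFin≡sum {suc n} f = ≡.cong (λ x → f zero + x) (sumFin≡sum (f ∘ suc))

  sumFin-cong : ∀ {f g : Fin n → Carrier} → (∀ i → f i ≈ g i) → sumFin R f ≈ sumFin R g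
  sumFin-cong {zero}  f≈g = refl
  sumFin-cong {suc n} f≈g = +-cong (f≈g zero) (sumFin-cong (f≈g ∘ suc))

  sumFin-0 : ∀ {f : Fin n → Carrier} → (∀ i → f i ≈ 0#) → sumFin R f ≈ 0#
  sumFin-0 {zero}  f≈0 = refl
  sumFin-0 {suc n} f≈0 = trans (+-cong (f≈0 zero) (sumFin-0 (f≈0 ∘ suc))) (+-identityˡ 0#)

  sumFin-+ : ∀ (f g : Fin n → Carrier) → sumFin R (λ i → f i + g i) ≈ sumFin R f + sumFin R g
  sumFin-+ f g rewrite sumFin≡sum (λ i → f i + g i) | sumFin≡sum f | sumFin≡sum g = ∑-distrib-+ f g

  sumFin-* : ∀ x (f : Fin n → Carrier) → sumFin R (λ i → x * f i) ≈ x * sumFin R f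
  sumFin-* x f rewrite sumFin≡sum (λ i → x * f i) | sumFin≡sum f = sym (*-distribˡ-sum x f)

  sumFin-neg : ∀ (f : Fin n → Carrier) → sumFin R (λ i → - f i) ≈ - sumFin R f
  sumFin-neg f = begin
    sumFin R (λ i → - f i)       ≈⟨ sumFin-cong (λ i → -1*x≈-x (f i)) ⟨
    sumFin R (λ i → - 1# * f i)  ≈⟨ sumFin-* (- 1#) f ⟩
    - 1# * sumFin R f            ≈⟨ -1*x≈-x _ ⟩
    - sumFin R f                 ∎

  sumFin-comm : ∀ {m n} (f : Fin m → Fin n → Carrier) →
    sumFin R (λ i → sumFin R (f i)) ≈ sumFin R (λ j → sumFin R (λ i → f i j))
  sumFin-comm f = begin
    sumFin R (λ i → sumFin R (f i))             ≈⟨ sumFin-cong (λ i → reflexive (sumFin≡sum (f i))) ⟩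
    sumFin R (λ i → sum (f i))                  ≡⟨ sumFin≡sum (λ i → sum (f i)) ⟩
    sum (λ i → sum (f i))                       ≈⟨ ∑-comm f ⟩
    sum (λ j → sum (λ i → f i j))               ≡⟨ sumFin≡sum (λ j → sum (λ i → f i j)) ⟨
    sumFin R (λ j → sum (λ i → f i j))          ≈⟨ sumFin-cong (λ j → reflexive (sumFin≡sum (λ i → f i j))) ⟨
    sumFin R (λ j → sumFin R (λ i → f i j))     ∎

  det-cong : ∀ {M N : Mat n} → (∀ i j → M i j ≈ N i j) → det R M ≈ det R N
  det-cong {zero}  M≈N = refl
  det-cong {suc n} M≈N = sumFin-cong λ j → *-congˡ {altSign R (toℕ j)}
    (*-cong (M≈N zero j) (det-cong λ i k → M≈N (suc i) (punchIn j k)))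

  -- Both expansions share the term of the corner entry. In every other term of the row expansion
  -- the minor still contains column 0, and by induction it is expanded along that column. The
  -- result is a double sum over a row `suc i` and a column `suc j`, with the minor `D i j` avoiding
  -- both; exchanging the sums gives the column expansion.
  det-expand-column : ∀ (M : Mat (suc n)) → det R M ≈
    sumFin R (λ i → altSign R (toℕ i) * (M i zero * det R (λ k l → M (punchIn i k) (suc l))))
  det-expand-column {zero}  M = refl
  det-expand-column {suc n} M = +-congˡ (begin
    sumFin R (λ j → - s j * (a j * det R (λ i k → M (suc i) (punchIn (suc j) k))))
      ≈⟨ sumFin-cong (λ j → *-congˡ { - s j} (*-congˡ {a j} (det-expand-column (λ i k → M (suc i) (punchIn (suc j) k))))) ⟩
    sumFin R (λ j → - s j * (a j * sumFin R (λ i → s i * (b i * D i j))))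
      ≈⟨ sumFin-cong (λ j → pull (s j) (a j) (λ i → s i * (b i * D i j))) ⟩
    sumFin R (λ j → sumFin R (λ i → - s j * (a j * (s i * (b i * D i j)))))
      ≈⟨ sumFin-comm (λ j i → - s j * (a j * (s i * (b i * D i j)))) ⟩
    sumFin R (λ i → sumFin R (λ j → - s j * (a j * (s i * (b i * D i j)))))
      ≈⟨ sumFin-cong (λ i → sumFin-cong λ j → exchange (s j) (a j) (s i) (b i) (D i j)) ⟩
    sumFin R (λ i → sumFin R (λ j → - s i * (b i * (s j * (a j * D i j)))))
      ≈⟨ sumFin-cong (λ i → pull (s i) (b i) (λ j → s j * (a j * D i j))) ⟨
    sumFin R (λ i → - s i * (b i * sumFin R (λ j → s j * (a j * D i j)))) ∎)
    where
    s : Fin (suc n) → Carrier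
    s j = altSign R (toℕ j)
    a b : Fin (suc n) → Carrier
    a j = M zero (suc j)
    b i = M (suc i) zero
    D : Fin (suc n) → Fin (suc n) → Carrier
    D i j = det R (λ k l → M (suc (punchIn i k)) (suc (punchIn j l)))
    pull : ∀ {m} x y (f : Fin m → Carrier) →
           - x * (y * sumFin R f) ≈ sumFin R (λ i → - x * (y * f i))
    pull x y f = begin
      - x * (y * sumFin R f)                  ≈⟨ *-congˡ (sumFin-* y f) ⟨
      - x * sumFin R (λ i → y * f i)          ≈⟨ sumFin-* (- x) (λ i → y * f i) ⟨
      sumFin R (λ i → - x * (y * f i))        ∎
    exchange : ∀ x y z w d → - x * (y * (z * (w * d))) ≈ - z * (w * (x * (y * d)))
    exchange = solve 5 (λ x y z w d →
      :- x :* (y :* (z :* (w :* d))) := :- z :* (w :* (x :* (y :* d)))) refl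

  -- Once the minors are transposed by induction, the row expansion of `flip M` is literally the
  -- column expansion of `M`.
  det-transpose : ∀ (M : Mat n) → det R (flip M) ≈ det R M
  det-transpose {zero}  M = refl
  det-transpose {suc n} M = begin
    det R (flip M)
      ≈⟨ sumFin-cong (λ j → *-congˡ {altSign R (toℕ j)} (*-congˡ {M j zero} (det-transpose (λ k l → M (punchIn j k) (suc l))))) ⟩
    sumFin R (λ i → altSign R (toℕ i) * (M i zero * det R (λ k l → M (punchIn i k) (suc l))))
      ≈⟨ det-expand-column M ⟨
    det R M ∎

  swap₀₁ : Fin (suc (suc n)) → Fin (suc (suc n))
  swap₀₁ zero          = suc zero
  swap₀₁ (suc zero)    = zero
  swap₀₁ (suc (suc i)) = suc (suc i)

  swap₀₁-punchIn₀ : ∀ (k : Fin (suc n)) → swap₀₁ (suc k) ≡ punchIn (suc zero) k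
  swap₀₁-punchIn₀ zero    = ≡.refl
  swap₀₁-punchIn₀ (suc k) = ≡.refl

  swap₀₁-punchIn₁ : ∀ (k : Fin (suc n)) → swap₀₁ (punchIn (suc zero) k) ≡ suc k
  swap₀₁-punchIn₁ zero    = ≡.refl
  swap₀₁-punchIn₁ (suc k) = ≡.refl

  swap₀₁-punchIn₂ : ∀ (j : Fin (suc n)) k →
    swap₀₁ (punchIn (suc (suc j)) k) ≡ punchIn (suc (suc j)) (swap₀₁ k)
  swap₀₁-punchIn₂ j zero          = ≡.refl
  swap₀₁-punchIn₂ j (suc zero)    = ≡.refl
  swap₀₁-punchIn₂ j (suc (suc k)) = ≡.refl

  -- The terms of columns 0 and 1 trade places, and their alternating signs are opposite. In each
  -- remaining term the minor still has the two columns in front, so induction applies.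
  det-swap-columns : ∀ (M : Mat (suc (suc n))) → det R (λ i j → M i (swap₀₁ j)) ≈ - det R M
  det-swap-columns {n} M = begin
    1# * (a₁ * det R (λ i k → M (suc i) (swap₀₁ (suc k)))) +
      (- 1# * (a₀ * det R (λ i k → M (suc i) (swap₀₁ (punchIn (suc zero) k)))) +
       sumFin R (λ j → s j * (a j * det R (λ i k → M (suc i) (swap₀₁ (punchIn (suc (suc j)) k))))))
      ≈⟨ +-cong (*-congˡ (*-congˡ (det-cong λ i k → reflexive (≡.cong (M (suc i)) (swap₀₁-punchIn₀ k)))))
           (+-cong (*-congˡ (*-congˡ (det-cong λ i k → reflexive (≡.cong (M (suc i)) (swap₀₁-punchIn₁ k)))))
             (trans (sumFin-cong (λ j → *-congˡ {s j} (*-congˡ {a j} (swapped j)))) tail-neg)) ⟩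
    1# * (a₁ * D (suc zero)) + (- 1# * (a₀ * D zero) + - T)
      ≈⟨ solve 5 (λ x d y e t → con (+ 1) :* (x :* d) :+ (:- con (+ 1) :* (y :* e) :+ :- t) :=
                   :- (con (+ 1) :* (y :* e) :+ (:- con (+ 1) :* (x :* d) :+ t)))
           refl a₁ (D (suc zero)) a₀ (D zero) T ⟩
    - det R M ∎
    where
    a₀ = M zero zero
    a₁ = M zero (suc zero)
    a : Fin n → Carrier
    a j = M zero (suc (suc j))
    s : Fin n → Carrier
    s j = altSign R (toℕ (suc (suc j)))
    D : Fin (suc (suc n)) → Carrier
    D j = det R (λ i k → M (suc i) (punchIn j k))
    T = sumFin R (λ j → s j * (a j * D (suc (suc j))))
    swapped : ∀ j → det R (λ i k → M (suc i) (swap₀₁ (punchIn (suc (suc j)) k))) ≈ - D (suc (suc j))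
    swapped = go n M
      where
      -- An element `j` of `Fin n` forces `n` to be a successor, so the minor has order at least
      -- two, as the induction hypothesis requires.
      go : ∀ n (M : Mat (suc (suc n))) (j : Fin n) →
           det R (λ i k → M (suc i) (swap₀₁ (punchIn (suc (suc j)) k))) ≈
           - det R (λ i k → M (suc i) (punchIn (suc (suc j)) k))
      go (suc n) M j = trans
        (det-cong λ i k → reflexive (≡.cong (M (suc i)) (swap₀₁-punchIn₂ j k)))
        (det-swap-columns (λ i k → M (suc i) (punchIn (suc (suc j)) k)))
    tail-neg : sumFin R (λ j → s j * (a j * - D (suc (suc j)))) ≈ - T
    tail-neg = trans
      (sumFin-cong λ j → solve 3 (λ x y z → x :* (y :* :- z) := :- (x :* (y :* z))) refl (s j) (a j) (D (suc (suc j))))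
      (sumFin-neg (λ j → s j * (a j * D (suc (suc j)))))

  -- A swap only shows that the determinant equals its own negative, which does not make it zero
  -- when 2 is a zero divisor. The expansion is therefore used again: the two leading terms cancel
  -- and the other minors repeat a column.
  det-repeated-columns : ∀ (M : Mat (suc (suc n))) → (∀ i → M i zero ≈ M i (suc zero)) → det R M ≈ 0#
  det-repeated-columns {n} M eq = begin
    1# * (M zero zero * D zero) + (- 1# * (M zero (suc zero) * D (suc zero)) +
      sumFin R (λ j → s j * (a j * D (suc (suc j)))))
      ≈⟨ +-cong (*-congˡ (*-cong (eq zero) (det-cong columns)))
           (+-congˡ (sumFin-0 λ j → trans (*-congˡ (trans (*-congˡ (rest n M eq j)) (zeroʳ (a j)))) (zeroʳ (s j)))) ⟩
    1# * (M zero (suc zero) * D (suc zero)) + (- 1# * (M zero (suc zero) * D (suc zero)) + 0#)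
      ≈⟨ solve 1 (λ x → con (+ 1) :* x :+ (:- con (+ 1) :* x :+ con (+ 0)) := con (+ 0)) refl
           (M zero (suc zero) * D (suc zero)) ⟩
    0# ∎
    where
    a : Fin n → Carrier
    a j = M zero (suc (suc j))
    s : Fin n → Carrier
    s j = altSign R (toℕ (suc (suc j)))
    D : Fin (suc (suc n)) → Carrier
    D j = det R (λ i k → M (suc i) (punchIn j k))
    columns : ∀ i k → M (suc i) (suc k) ≈ M (suc i) (punchIn (suc zero) k)
    columns i zero    = sym (eq (suc i))
    columns i (suc k) = refl
    rest : ∀ n (M : Mat (suc (suc n))) → (∀ i → M i zero ≈ M i (suc zero)) → (j : Fin n) →
           det R (λ i k → M (suc i) (punchIn (suc (suc j)) k)) ≈ 0#
    rest (suc n) M eq j =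
      det-repeated-columns (λ i k → M (suc i) (punchIn (suc (suc j)) k)) (eq ∘ suc)

  det-repeated-rows : ∀ (M : Mat (suc (suc n))) → (∀ j → M zero j ≈ M (suc zero) j) → det R M ≈ 0#
  det-repeated-rows M eq = trans (sym (det-transpose M)) (det-repeated-columns (flip M) eq)

  -- Permutations and their signs.

  -- The sign is characterised by its effect on determinants instead of by counting inversions.
  -- `sign²` makes it invertible, so that it can be cancelled, and makes it vanish when rows and
  -- columns are permuted together.
  record Signed (π : Fin n → Fin n) : Set (c ⊔ r) where
    field
      sign        : Carrier
      sign²       : sign * sign ≈ 1#
      permuteRows : ∀ M → det R (M ∘ π) ≈ sign * det R M

    permuteColumns : ∀ M → det R (λ i j → M i (π j)) ≈ sign * det R M
    permuteColumns M = begin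
      det R (λ i j → M i (π j))  ≈⟨ det-transpose (λ i j → M i (π j)) ⟨
      det R (flip M ∘ π)         ≈⟨ permuteRows (flip M) ⟩
      sign * det R (flip M)      ≈⟨ *-congˡ (det-transpose M) ⟩
      sign * det R M             ∎

    cancel : ∀ {x y} → sign * x ≈ sign * y → x ≈ y
    cancel {x} {y} eq = begin
      x                  ≈⟨ *-identityˡ x ⟨
      1# * x             ≈⟨ *-congʳ sign² ⟨
      sign * sign * x    ≈⟨ *-assoc _ _ _ ⟩
      sign * (sign * x)  ≈⟨ *-congˡ eq ⟩
      sign * (sign * y)  ≈⟨ *-assoc _ _ _ ⟨
      sign * sign * y    ≈⟨ *-congʳ sign² ⟩
      1# * y             ≈⟨ *-identityˡ y ⟩
      y                  ∎

    permuteBoth : ∀ M → det R (λ i j → M (π i) (π j)) ≈ det R M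
    permuteBoth M = begin
      det R (λ i j → M (π i) (π j))       ≈⟨ permuteRows (λ i j → M i (π j)) ⟩
      sign * det R (λ i j → M i (π j))    ≈⟨ *-congˡ (permuteColumns M) ⟩
      sign * (sign * det R M)             ≈⟨ *-assoc _ _ _ ⟨
      sign * sign * det R M               ≈⟨ *-congʳ sign² ⟩
      1# * det R M                        ≈⟨ *-identityˡ _ ⟩
      det R M                             ∎

  open Signed

  signed-cong : ∀ {π ρ : Fin n → Fin n} → π ≗ ρ → Signed π → Signed ρ
  signed-cong π≗ρ p = record
    { sign        = sign p
    ; sign²       = sign² p
    ; permuteRows = λ M → trans (det-cong λ i j → reflexive (≡.cong (λ k → M k j) (≡.sym (π≗ρ i)))) (permuteRows p M)
    }

  signed-id : Signed {n} id
  signed-id = record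
    { sign = 1# ; sign² = *-identityˡ 1# ; permuteRows = λ M → sym (*-identityˡ _) }

  signed-∘ : ∀ {π ρ : Fin n → Fin n} → Signed π → Signed ρ → Signed (π ∘ ρ)
  signed-∘ {π = π} p q = record
    { sign        = sign q * sign p
    ; sign²       = begin
        sign q * sign p * (sign q * sign p)
          ≈⟨ solve 2 (λ x y → x :* y :* (x :* y) := (x :* x) :* (y :* y)) refl (sign q) (sign p) ⟩
        (sign q * sign q) * (sign p * sign p) ≈⟨ *-cong (sign² q) (sign² p) ⟩
        1# * 1#                               ≈⟨ *-identityˡ 1# ⟩
        1#                                    ∎
    ; permuteRows = λ M → trans (permuteRows q (M ∘ π))
        (trans (*-congˡ (permuteRows p M)) (sym (*-assoc _ _ _)))
    }

  -- Row 0 stays in place, so every minor in the expansion along it acquires the same sign.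
  signed-lift : ∀ {π : Fin n → Fin n} → Signed π → Signed (lift 1 π)
  signed-lift {π = π} p = record
    { sign        = sign p
    ; sign²       = sign² p
    ; permuteRows = λ M → trans
        (sumFin-cong λ j → trans
          (*-congˡ {altSign R (toℕ j)} (*-congˡ {M zero j} (permuteRows p (λ i k → M (suc i) (punchIn j k)))))
          (solve 4 (λ s m e d → s :* (m :* (e :* d)) := e :* (s :* (m :* d))) refl
            (altSign R (toℕ j)) (M zero j) (sign p) (det R (λ i k → M (suc i) (punchIn j k)))))
        (sumFin-* (sign p) (λ j → altSign R (toℕ j) * (M zero j * det R (λ i k → M (suc i) (punchIn j k)))))
    }

  signed-swap₀₁ : Signed (swap₀₁ {n})
  signed-swap₀₁ = record
    { sign        = - 1#
    ; sign²       = solve 0 (:- con (+ 1) :* :- con (+ 1) := con (+ 1)) refl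
    ; permuteRows = λ M → begin
        det R (M ∘ swap₀₁)                   ≈⟨ det-transpose (M ∘ swap₀₁) ⟨
        det R (λ i j → M (swap₀₁ j) i)       ≈⟨ det-swap-columns (flip M) ⟩
        - det R (flip M)                     ≈⟨ -‿cong (det-transpose M) ⟩
        - det R M                            ≈⟨ -1*x≈-x _ ⟨
        - 1# * det R M                       ∎
    }

  front : Fin (suc n) → Fin (suc n) → Fin (suc n)
  front k zero    = k
  front k (suc i) = punchIn k i

  -- Bringing row `suc k` to the front is done by bringing it to position 1 within the rows below
  -- row 0, followed by one adjacent swap.
  signed-front : ∀ (k : Fin (suc n)) → Signed (front k)
  signed-front zero = signed-cong (λ { zero → ≡.refl ; (suc i) → ≡.refl }) signed-id
  signed-front {suc n} (suc k) =
    signed-cong (λ { zero → ≡.refl ; (suc zero) → ≡.refl ; (suc (suc i)) → ≡.refl })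
      (signed-∘ (signed-lift (signed-front k)) signed-swap₀₁)

  -- Peels off one value at a time: `π` is `front (π zero)` composed with the lift of a smaller
  -- injection `π′`, obtained by deleting the value `π zero`.
  signed-injective : ∀ (π : Fin n → Fin n) → (∀ {i j} → π i ≡ π j → i ≡ j) → Signed π
  signed-injective {zero}  π inj = signed-cong (λ ()) signed-id
  signed-injective {suc n} π inj =
    signed-cong (λ { zero → ≡.refl ; (suc i) → Finₚ.punchIn-punchOut (π₀≢ i) })
      (signed-∘ (signed-front (π zero)) (signed-lift (signed-injective π′ π′-inj)))
    where
    π₀≢ : ∀ i → π zero ≢ π (suc i)
    π₀≢ i eq with () ← inj eq
    π′ : Fin n → Fin n
    π′ i = punchOut (π₀≢ i)
    π′-inj : ∀ {i j} → π′ i ≡ π′ j → i ≡ j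
    π′-inj {i} {j} eq = Finₚ.suc-injective (inj (Finₚ.punchOut-injective (π₀≢ i) (π₀≢ j) eq))

  -- Multilinearity and the elimination of one twin vertex.

  det-first-row-+ : ∀ (M A B : Mat (suc n)) → (∀ j → M zero j ≈ A zero j + B zero j) →
    (∀ i j → M (suc i) j ≈ A (suc i) j) → (∀ i j → M (suc i) j ≈ B (suc i) j) →
    det R M ≈ det R A + det R B
  det-first-row-+ {n} M A B M₀ M≈A M≈B = trans
    (sumFin-cong λ j → let s = altSign R (toℕ j) in begin
      s * (M zero j * D M j)                       ≈⟨ *-congˡ (*-congʳ (M₀ j)) ⟩
      s * ((A zero j + B zero j) * D M j)
        ≈⟨ solve 4 (λ s a b d → s :* ((a :+ b) :* d) := s :* (a :* d) :+ s :* (b :* d)) refl s _ _ _ ⟩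
      s * (A zero j * D M j) + s * (B zero j * D M j)
        ≈⟨ +-cong (*-congˡ (*-congˡ (det-cong λ i k → M≈A i (punchIn j k))))
                  (*-congˡ (*-congˡ (det-cong λ i k → M≈B i (punchIn j k)))) ⟩
      s * (A zero j * D A j) + s * (B zero j * D B j) ∎)
    (sumFin-+ (λ j → altSign R (toℕ j) * (A zero j * D A j)) (λ j → altSign R (toℕ j) * (B zero j * D B j)))
    where
    D : Mat (suc n) → Fin (suc n) → Carrier
    D M j = det R (λ i k → M (suc i) (punchIn j k))

  det-equal-rows : ∀ (M : Mat (suc n)) p → (∀ j → M zero j ≈ M (suc p) j) → det R M ≈ 0#
  det-equal-rows {suc n} M p eq = cancel σ (begin
    sign σ * det R M              ≈⟨ permuteRows σ M ⟨
    det R (M ∘ lift 1 (front p))  ≈⟨ det-repeated-rows (M ∘ lift 1 (front p)) eq ⟩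
    0#                            ≈⟨ zeroʳ (sign σ) ⟨
    sign σ * 0#                   ∎)
    where σ = signed-lift (signed-front p)

  det-equal-columns : ∀ (M : Mat (suc n)) p → (∀ i → M i zero ≈ M i (suc p)) → det R M ≈ 0#
  det-equal-columns M p eq = trans (sym (det-transpose M)) (det-equal-rows (flip M) p eq)

  det-first-column-+ : ∀ (M A B : Mat (suc n)) → (∀ i → M i zero ≈ A i zero + B i zero) →
    (∀ i j → M i (suc j) ≈ A i (suc j)) → (∀ i j → M i (suc j) ≈ B i (suc j)) →
    det R M ≈ det R A + det R B
  det-first-column-+ M A B M₀ M≈A M≈B = begin
    det R M                           ≈⟨ det-transpose M ⟨
    det R (flip M)                    ≈⟨ det-first-row-+ (flip M) (flip A) (flip B) M₀ (flip M≈A) (flip M≈B) ⟩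
    det R (flip A) + det R (flip B)   ≈⟨ +-cong (det-transpose A) (det-transpose B) ⟩
    det R A + det R B                 ∎

  δ : ∀ {I : Set} → DecidableEquality I → I → I → Carrier
  δ _≟_ x y = if does (x ≟ y) then 1# else 0#

  δ-refl : ∀ {I : Set} (_≟_ : DecidableEquality I) x → δ _≟_ x x ≡ 1#
  δ-refl _≟_ x with x ≟ x
  ... | yes _   = ≡.refl
  ... | no x≢x = contradiction ≡.refl x≢x

  δ-≢ : ∀ {I : Set} (_≟_ : DecidableEquality I) {x y} → x ≢ y → δ _≟_ x y ≡ 0#
  δ-≢ _≟_ {x} {y} x≢y with x ≟ y
  ... | yes x≡y = contradiction x≡y x≢y
  ... | no _    = ≡.refl

  δ-injective : ∀ {I K : Set} (_≟_ : DecidableEquality I) (_≟′_ : DecidableEquality K) (f : I → K) →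
    (∀ {x y} → f x ≡ f y → x ≡ y) → ∀ x y → δ _≟′_ (f x) (f y) ≡ δ _≟_ x y
  δ-injective _≟_ _≟′_ f inj x y with x ≟ y
  ... | yes ≡.refl = δ-refl _≟′_ (f x)
  ... | no x≢y     = δ-≢ _≟′_ (x≢y ∘ inj)

  δᶠ : Fin n → Fin n → Carrier
  δᶠ = δ Finₚ._≟_

  addFirstRow : Fin n → Mat (suc n) → Mat (suc n)
  addFirstRow p M zero    j = M zero j
  addFirstRow p M (suc i) j = M (suc i) j + δᶠ i p * M zero j

  -- Linearity is available only in row 0, so the changed row is moved to the front. The surplus
  -- summand `E` then has row 0 of `M` in its two top positions and vanishes.
  det-addFirstRow : ∀ p (M : Mat (suc n)) → det R (addFirstRow p M) ≈ det R M
  det-addFirstRow {suc n} p M = cancel σ (begin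
    sign σ * det R N         ≈⟨ permuteRows σ N ⟨
    det R (N ∘ front q)      ≈⟨ det-first-row-+ (N ∘ front q) (M ∘ front q) E first others others ⟩
    det R (M ∘ front q) + det R E
      ≈⟨ +-cong (permuteRows σ M) (det-repeated-rows E (λ j → refl)) ⟩
    sign σ * det R M + 0#    ≈⟨ +-identityʳ _ ⟩
    sign σ * det R M         ∎)
    where
    N = addFirstRow p M
    q = suc p
    σ = signed-front q
    E : Mat (suc (suc n))
    E zero    j = M zero j
    E (suc i) j = M (punchIn q i) j
    first : ∀ j → N q j ≈ M q j + M zero j
    first j = +-congˡ (trans (*-congʳ (reflexive (δ-refl Finₚ._≟_ p))) (*-identityˡ _))
    others : ∀ i j → N (punchIn q i) j ≈ M (punchIn q i) j
    others zero    j = refl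
    others (suc i) j = trans
      (+-congˡ (trans (*-congʳ (reflexive (δ-≢ Finₚ._≟_ (Finₚ.punchInᵢ≢i p i)))) (zeroˡ _)))
      (+-identityʳ _)

  -- Subtract column p from column 0, then add row 0 to row p: this turns
  -- column 0 into d e₀.
  det-merge : ∀ (M : Mat (suc n)) p d → M zero zero ≈ M zero (suc p) + d →
    (∀ i → M (suc i) zero + d * δᶠ i p ≈ M (suc i) (suc p)) →
    det R M ≈ d * det R (λ i j → M (suc i) (suc j) + δᶠ i p * M zero (suc j))
  det-merge {n} M p d M₀₀ Mᵢ₀ = begin
    det R M                      ≈⟨ det-first-column-+ M M⁻ M⁼ columns (λ _ _ → refl) (λ _ _ → refl) ⟩
    det R M⁻ + det R M⁼          ≈⟨ +-congˡ (det-equal-columns M⁼ p (λ _ → refl)) ⟩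
    det R M⁻ + 0#                ≈⟨ +-identityʳ _ ⟩
    det R M⁻                     ≈⟨ det-addFirstRow p M⁻ ⟨
    det R N                      ≈⟨ det-expand-column N ⟩
    1# * (d * D) + sumFin R (λ i → - altSign R (toℕ i) * (N (suc i) zero * N′ i))
      ≈⟨ +-cong (*-identityˡ _) (sumFin-0 λ i → trans
           (*-congˡ { - altSign R (toℕ i)} (trans (*-congʳ (column₀ i)) (zeroˡ (N′ i)))) (zeroʳ _)) ⟩
    d * D + 0#                   ≈⟨ +-identityʳ _ ⟩
    d * D                        ∎
    where
    -- The difference of columns 0 and `suc p`, as the two hypotheses prescribe: `d` in row 0, `- d`
    -- in row `suc p`, and zero elsewhere. Adding row 0 to row `suc p` cancels the second of these
    -- entries.
    e : Fin (suc n) → Carrier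
    e zero    = d
    e (suc i) = - (d * δᶠ i p)
    M⁻ M⁼ N : Mat (suc n)
    M⁻ i zero    = e i
    M⁻ i (suc j) = M i (suc j)
    M⁼ i zero    = M i (suc p)
    M⁼ i (suc j) = M i (suc j)
    N = addFirstRow p M⁻
    N′ : Fin n → Carrier
    N′ i = det R (λ k l → N (punchIn (suc i) k) (suc l))
    D = det R (λ i j → M (suc i) (suc j) + δᶠ i p * M zero (suc j))
    columns : ∀ i → M i zero ≈ M⁻ i zero + M⁼ i zero
    columns zero    = trans M₀₀ (+-comm _ _)
    columns (suc i) = trans
      (solve 2 (λ x y → x := :- y :+ (x :+ y)) refl (M (suc i) zero) (d * δᶠ i p))
      (+-congˡ (Mᵢ₀ i))
    column₀ : ∀ i → N (suc i) zero ≈ 0#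
    column₀ i = solve 2 (λ x y → :- (x :* y) :+ y :* x := con (+ 0)) refl d (δᶠ i p)

-- Index sets built as disjoint unions.

-- With codes for iterated disjoint unions, the entries of a block matrix are given by pattern
-- matching on the blocks, and `enum` alone deals with positions in `Fin`.
data Shape : Set where
  fin : ℕ → Shape
  _⊞_ : Shape → Shape → Shape

infixr 5 _⊞_

El : Shape → Set
El (fin n) = Fin n
El (s ⊞ t) = El s ⊎ El t

size : Shape → ℕ
size (fin n) = n
size (s ⊞ t) = size s ℕ.+ size t

enum : ∀ s → Fin (size s) ↔ El s
enum (fin n) = ↔-refl
enum (s ⊞ t) = ↔-trans Finₚ.+↔⊎ (⊎-cong (enum s) (enum t))

_≟ˢ_ : ∀ {s} → DecidableEquality (El s)
_≟ˢ_ {fin n} = Finₚ._≟_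
_≟ˢ_ {s ⊞ t} = Sumₚ.≡-dec _≟ˢ_ _≟ˢ_

↔-injective : ∀ {A B : Set} (φ : A ↔ B) {x y} → Inverse.to φ x ≡ Inverse.to φ y → x ≡ y
↔-injective φ {x} {y} eq = ≡.trans (≡.sym (strictlyInverseʳ x)) (≡.trans (≡.cong from eq) (strictlyInverseʳ y))
  where open Inverse φ

-- Puts `inj₁ zero` at index 0 and follows `e` afterwards. Deleting index 0 thus leaves the
-- enumeration `e` of the remaining vertices, as the induction in `DET-merge` requires.
cons-enum : ∀ {n p} {A : Set} → Fin n ↔ (Fin p ⊎ A) → Fin (suc n) ↔ (Fin (suc p) ⊎ A)
cons-enum {n} {p} {A} e = mk↔ₛ′ to′ from′ to∘from from∘to
  where
  open Inverse e
  to′ : Fin (suc n) → Fin (suc p) ⊎ A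
  to′ zero    = inj₁ zero
  to′ (suc i) = map₁ suc (to i)
  from′ : Fin (suc p) ⊎ A → Fin (suc n)
  from′ (inj₁ zero)    = zero
  from′ (inj₁ (suc j)) = suc (from (inj₁ j))
  from′ (inj₂ y)       = suc (from (inj₂ y))
  to∘from : ∀ y → to′ (from′ y) ≡ y
  to∘from (inj₁ zero)    = ≡.refl
  to∘from (inj₁ (suc j)) = ≡.cong (map₁ suc) (strictlyInverseˡ (inj₁ j))
  to∘from (inj₂ y)       = ≡.cong (map₁ suc) (strictlyInverseˡ (inj₂ y))
  from-map₁ : ∀ z → from′ (map₁ suc z) ≡ suc (from z)
  from-map₁ (inj₁ _) = ≡.refl
  from-map₁ (inj₂ _) = ≡.refl
  from∘to : ∀ i → from′ (to′ i) ≡ i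
  from∘to zero    = ≡.refl
  from∘to (suc i) = ≡.trans (from-map₁ (to i)) (≡.cong suc (strictlyInverseʳ i))

module _ {a ℓ} (M : CommutativeMonoid a ℓ) where
  open CommutativeMonoid M
  open import Algebra.Properties.CommutativeMonoid.Sum M using (sum)

  -- Stated for a commutative monoid because it serves twice: multiplicatively for the factors split
  -- off by merging, and additively for counting the merged vertices.
  sum-splitAt : ∀ m {n} (h : Fin m ⊎ Fin n → Carrier) →
    sum (h ∘ splitAt m) ≈ sum (h ∘ inj₁) ∙ sum (h ∘ inj₂)
  sum-splitAt zero    h = sym (identityˡ _)
  sum-splitAt (suc m) h = trans (∙-congˡ (sum-splitAt m (h ∘ map₁ suc))) (sym (assoc _ _ _))

-- Determinants over disjoint unions and simultaneous merging.

module ShapedDeterminant {c r} (R : CommutativeRing c r) where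
  open CommutativeRing R hiding (zero)
  open IntegerSolver R
  open Determinant R
  open import Algebra.Properties.CommutativeMonoid.Sum *-commutativeMonoid using () renaming (sum to prod)
  open import Relation.Binary.Reasoning.Setoid setoid

  DET : ∀ s → (El s → El s → Carrier) → Carrier
  DET s M = det R (λ i j → M (to i) (to j))
    where open Inverse (enum s)

  DET-cong : ∀ s {M N : El s → El s → Carrier} → (∀ x y → M x y ≈ N x y) → DET s M ≈ DET s N
  DET-cong s M≈N = det-cong λ i j → M≈N (Inverse.to (enum s) i) (Inverse.to (enum s) j)

  -- Two enumerations differ by a permutation that acts on rows and columns alike, so its sign
  -- enters squared.
  det-reindex : ∀ {m n} {A : Set} (e : Fin m ↔ A) (e′ : Fin n ↔ A) (M : A → A → Carrier) →
    det R (λ i j → M (Inverse.to e i) (Inverse.to e j)) ≈ det R (λ i j → M (Inverse.to e′ i) (Inverse.to e′ j))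
  -- The composite bijection forces `m` and `n` to agree; after this match `π` maps one `Fin n` to
  -- itself and has a sign.
  det-reindex e e′ M with ≡.refl ← ↔⇒≡ (↔-trans e (↔-sym e′)) = begin
    det R (λ i j → M (E.to i) (E.to j))
      ≈⟨ det-cong (λ i j → reflexive (≡.cong₂ M (E′.strictlyInverseˡ (E.to i)) (E′.strictlyInverseˡ (E.to j)))) ⟨
    det R (λ i j → M (E′.to (π i)) (E′.to (π j)))
      ≈⟨ Signed.permuteBoth (signed-injective π (↔-injective (↔-trans e (↔-sym e′)))) (λ i j → M (E′.to i) (E′.to j)) ⟩
    det R (λ i j → M (E′.to i) (E′.to j)) ∎
    where
    module E = Inverse e
    module E′ = Inverse e′
    π = E′.from ∘ E.to

  DET-reindex : ∀ s t (φ : El s ↔ El t) (M : El t → El t → Carrier) →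
    DET s (λ x y → M (Inverse.to φ x) (Inverse.to φ y)) ≈ DET t M
  DET-reindex s t φ M = det-reindex (↔-trans (enum s) φ) (enum t) M

  δˢ : ∀ {s} → El s → El s → Carrier
  δˢ = δ _≟ˢ_

  δ-subst : ∀ {I : Set} (_≟_ : DecidableEquality I) (g : I → Carrier) x y → g x * δ _≟_ x y ≈ g y * δ _≟_ x y
  δ-subst _≟_ g x y with x ≟ y
  ... | yes ≡.refl = refl
  ... | no _       = trans (zeroʳ _) (sym (zeroʳ _))

  -- The vertices `inj₁ i` are absorbed one after another into their targets `f i`, and several of
  -- them may share a target. The hypotheses say that columns `inj₁ i` and `inj₂ (f i)` differ by
  -- `d i` times the difference of the two unit vectors. In the result each target row has gained
  -- the rows of everything merged into it, while its column is unchanged.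
  DET-merge : ∀ p s (f : Fin p → El s) (d : Fin p → Carrier) (M : El (fin p ⊞ s) → El (fin p ⊞ s) → Carrier) →
    (∀ i j → M (inj₁ j) (inj₁ i) ≈ M (inj₁ j) (inj₂ (f i)) + d i * δᶠ j i) →
    (∀ i x → M (inj₂ x) (inj₁ i) + d i * δˢ x (f i) ≈ M (inj₂ x) (inj₂ (f i))) →
    DET (fin p ⊞ s) M ≈
      prod d * DET s (λ x y → M (inj₂ x) (inj₂ y) + sumFin R (λ i → δˢ x (f i) * M (inj₁ i) (inj₂ y)))
  DET-merge zero s f d M _ _ = begin
    DET (fin 0 ⊞ s) M                              ≈⟨ DET-reindex s (fin 0 ⊞ s) ψ M ⟨
    DET s (λ x y → M (inj₂ x) (inj₂ y))            ≈⟨ DET-cong s (λ x y → +-identityʳ (M (inj₂ x) (inj₂ y))) ⟨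
    DET s (λ x y → M (inj₂ x) (inj₂ y) + 0#)       ≈⟨ *-identityˡ _ ⟨
    1# * DET s (λ x y → M (inj₂ x) (inj₂ y) + 0#)  ∎
    where
    ψ : El s ↔ (Fin 0 ⊎ El s)
    ψ = mk↔ₛ′ inj₂ [ (λ ()) , id ] [ (λ ()) , (λ _ → ≡.refl) ] (λ _ → ≡.refl)
  DET-merge (suc p) s f d M H₁ H₂ = begin
    DET (fin (suc p) ⊞ s) M
      ≈⟨ det-reindex (enum (fin (suc p) ⊞ s)) (cons-enum e) M ⟩
    det R (λ i j → M (to⁺ i) (to⁺ j))
      ≈⟨ det-merge (λ i j → M (to⁺ i) (to⁺ j)) (E.from z) (d zero) first-row other-rows ⟩
    d zero * det R (λ i j → M (to⁺ (suc i)) (to⁺ (suc j)) + δᶠ i (E.from z) * M (to⁺ zero) (to⁺ (suc j)))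
      ≈⟨ *-congˡ (det-cong λ i j → +-congˡ (*-congʳ (δ-from i))) ⟩
    d zero * DET (fin p ⊞ s) M′
      ≈⟨ *-congˡ (DET-merge p s (f ∘ suc) (d ∘ suc) M′ H₁′ H₂′) ⟩
    d zero * (prod (d ∘ suc) * DET s M″)
      ≈⟨ *-assoc _ _ _ ⟨
    prod d * DET s M″
      ≈⟨ *-congˡ (DET-cong s summed) ⟩
    prod d * DET s (λ x y → M (inj₂ x) (inj₂ y) + sumFin R (λ i → δˢ x (f i) * M (inj₁ i) (inj₂ y))) ∎
    where
    e = enum (fin p ⊞ s)
    module E = Inverse e
    to⁺ = Inverse.to (cons-enum e)
    z : El (fin p ⊞ s)
    z = inj₂ (f zero)
    M′ : El (fin p ⊞ s) → El (fin p ⊞ s) → Carrier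
    M′ x y = M (map₁ suc x) (map₁ suc y) + δˢ x z * M (inj₁ zero) (map₁ suc y)
    M″ : El s → El s → Carrier
    M″ x y = M′ (inj₂ x) (inj₂ y) + sumFin R (λ i → δˢ x (f (suc i)) * M′ (inj₁ i) (inj₂ y))
    δ-from : ∀ i → δᶠ i (E.from z) ≈ δˢ (E.to i) z
    δ-from i = begin
      δᶠ i (E.from z)                  ≡⟨ δ-injective Finₚ._≟_ _≟ˢ_ E.to (↔-injective e) i (E.from z) ⟨
      δˢ (E.to i) (E.to (E.from z))    ≡⟨ ≡.cong (δˢ (E.to i)) (E.strictlyInverseˡ z) ⟩
      δˢ (E.to i) z                    ∎
    first-row : M (to⁺ zero) (to⁺ zero) ≈ M (to⁺ zero) (to⁺ (suc (E.from z))) + d zero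
    first-row = begin
      M (inj₁ zero) (inj₁ zero)                  ≈⟨ H₁ zero zero ⟩
      M (inj₁ zero) (map₁ suc z) + d zero * 1#   ≈⟨ +-congˡ (*-identityʳ _) ⟩
      M (inj₁ zero) (map₁ suc z) + d zero
        ≡⟨ ≡.cong (λ w → M (inj₁ zero) (map₁ suc w) + d zero) (E.strictlyInverseˡ z) ⟨
      M (inj₁ zero) (map₁ suc (E.to (E.from z))) + d zero ∎
    row : ∀ x → M (map₁ suc x) (inj₁ zero) + d zero * δˢ x z ≈ M (map₁ suc x) (inj₂ (f zero))
    row (inj₁ j) = begin
      M (inj₁ (suc j)) (inj₁ zero) + d zero * 0#                         ≈⟨ +-congʳ (H₁ zero (suc j)) ⟩
      M (inj₁ (suc j)) (inj₂ (f zero)) + d zero * 0# + d zero * 0#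
        ≈⟨ solve 2 (λ m d → m :+ d :* con (+ 0) :+ d :* con (+ 0) := m) refl _ _ ⟩
      M (inj₁ (suc j)) (inj₂ (f zero))                                   ∎
    row (inj₂ x) = H₂ zero x
    other-rows : ∀ i → M (to⁺ (suc i)) (to⁺ zero) + d zero * δᶠ i (E.from z) ≈ M (to⁺ (suc i)) (to⁺ (suc (E.from z)))
    other-rows i = begin
      M (map₁ suc (E.to i)) (inj₁ zero) + d zero * δᶠ i (E.from z)     ≈⟨ +-congˡ (*-congˡ (δ-from i)) ⟩
      M (map₁ suc (E.to i)) (inj₁ zero) + d zero * δˢ (E.to i) z       ≈⟨ row (E.to i) ⟩
      M (map₁ suc (E.to i)) (map₁ suc z)
        ≡⟨ ≡.cong (λ w → M (map₁ suc (E.to i)) (map₁ suc w)) (E.strictlyInverseˡ z) ⟨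
      M (map₁ suc (E.to i)) (map₁ suc (E.to (E.from z)))               ∎
    H₁′ : ∀ i j → M′ (inj₁ j) (inj₁ i) ≈ M′ (inj₁ j) (inj₂ (f (suc i))) + d (suc i) * δᶠ j i
    H₁′ i j = begin
      M (inj₁ (suc j)) (inj₁ (suc i)) + 0# * M (inj₁ zero) (inj₁ (suc i))   ≈⟨ +-congʳ (H₁ (suc i) (suc j)) ⟩
      M (inj₁ (suc j)) (inj₂ (f (suc i))) + d (suc i) * δᶠ j i + 0# * M (inj₁ zero) (inj₁ (suc i))
        ≈⟨ solve 4 (λ m x a b → m :+ x :+ con (+ 0) :* a := m :+ con (+ 0) :* b :+ x) refl _ _ _ _ ⟩
      M (inj₁ (suc j)) (inj₂ (f (suc i))) + 0# * M (inj₁ zero) (inj₂ (f (suc i))) + d (suc i) * δᶠ j i ∎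
    -- Row `inj₁ zero` has been added to row `f zero`. By `H₁` the two columns to be compared agree
    -- in that added row, because `zero` differs from `suc i`; the twin relation persists.
    H₂′ : ∀ i x → M′ (inj₂ x) (inj₁ i) + d (suc i) * δˢ x (f (suc i)) ≈ M′ (inj₂ x) (inj₂ (f (suc i)))
    H₂′ i x = begin
      M (inj₂ x) (inj₁ (suc i)) + δˢ x (f zero) * M (inj₁ zero) (inj₁ (suc i)) + d (suc i) * δˢ x (f (suc i))
        ≈⟨ +-congʳ (+-congˡ (*-congˡ (H₁ (suc i) zero))) ⟩
      M (inj₂ x) (inj₁ (suc i)) + δˢ x (f zero) * (M (inj₁ zero) (inj₂ (f (suc i))) + d (suc i) * 0#)
        + d (suc i) * δˢ x (f (suc i))
        ≈⟨ solve 5 (λ m e n d x → m :+ e :* (n :+ d :* con (+ 0)) :+ d :* x := (m :+ d :* x) :+ e :* n) refl _ _ _ _ _ ⟩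
      M (inj₂ x) (inj₁ (suc i)) + d (suc i) * δˢ x (f (suc i)) + δˢ x (f zero) * M (inj₁ zero) (inj₂ (f (suc i)))
        ≈⟨ +-congʳ (H₂ (suc i) x) ⟩
      M (inj₂ x) (inj₂ (f (suc i))) + δˢ x (f zero) * M (inj₁ zero) (inj₂ (f (suc i))) ∎
    summed : ∀ x y → M″ x y ≈ M (inj₂ x) (inj₂ y) + sumFin R (λ i → δˢ x (f i) * M (inj₁ i) (inj₂ y))
    summed x y = trans (+-assoc _ _ _) (+-congˡ (+-congˡ (sumFin-cong λ i → *-congˡ {δˢ x (f (suc i))}
      (solve 2 (λ a b → a :+ con (+ 0) :* b := a) refl (M (inj₁ (suc i)) (inj₂ y)) (M (inj₁ zero) (inj₂ y))))))

-- Blocks of twins and their representatives.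

-- An entry `n` encodes a block of `suc n` vertices. Being nonempty, the block has a representative,
-- its vertex `zero`, and exactly `n` extras to be merged into it.
blocks extras : ∀ {k} → Vec ℕ k → Shape
blocks []       = fin 0
blocks (n ∷ ns) = fin (suc n) ⊞ blocks ns
extras []       = fin 0
extras (n ∷ ns) = fin n ⊞ extras ns

blockOf : ∀ {k} (ns : Vec ℕ k) → El (blocks ns) → Fin k
blockOf (n ∷ ns) (inj₁ _) = zero
blockOf (n ∷ ns) (inj₂ x) = suc (blockOf ns x)

blockOfExtra : ∀ {k} (ns : Vec ℕ k) → El (extras ns) → Fin k
blockOfExtra (n ∷ ns) (inj₁ _) = zero
blockOfExtra (n ∷ ns) (inj₂ x) = suc (blockOfExtra ns x)

representatives : ∀ {k} (ns : Vec ℕ k) → El (extras ns ⊞ fin k) ↔ El (blocks ns)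
representatives {k} ns = mk↔ₛ′ (to ns) (from ns) (to∘from ns) (from∘to ns)
  where
  to : ∀ {k} (ns : Vec ℕ k) → El (extras ns ⊞ fin k) → El (blocks ns)
  to []       (inj₁ x)        = x
  to (n ∷ ns) (inj₁ (inj₁ i)) = inj₁ (suc i)
  to (n ∷ ns) (inj₁ (inj₂ x)) = inj₂ (to ns (inj₁ x))
  to (n ∷ ns) (inj₂ zero)     = inj₁ zero
  to (n ∷ ns) (inj₂ (suc c))  = inj₂ (to ns (inj₂ c))
  from : ∀ {k} (ns : Vec ℕ k) → El (blocks ns) → El (extras ns ⊞ fin k)
  from []       x              = inj₁ x
  from (n ∷ ns) (inj₁ zero)    = inj₂ zero
  from (n ∷ ns) (inj₁ (suc i)) = inj₁ (inj₁ i)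
  from (n ∷ ns) (inj₂ y)       = Sum.map inj₂ suc (from ns y)
  to-map : ∀ {k} n (ns : Vec ℕ k) z → to (n ∷ ns) (Sum.map inj₂ suc z) ≡ inj₂ (to ns z)
  to-map n ns (inj₁ _) = ≡.refl
  to-map n ns (inj₂ _) = ≡.refl
  to∘from : ∀ {k} (ns : Vec ℕ k) y → to ns (from ns y) ≡ y
  to∘from []       x              = ≡.refl
  to∘from (n ∷ ns) (inj₁ zero)    = ≡.refl
  to∘from (n ∷ ns) (inj₁ (suc i)) = ≡.refl
  to∘from (n ∷ ns) (inj₂ y)       = ≡.trans (to-map n ns (from ns y)) (≡.cong inj₂ (to∘from ns y))
  from∘to : ∀ {k} (ns : Vec ℕ k) x → from ns (to ns x) ≡ x
  from∘to []       (inj₁ x)        = ≡.refl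
  from∘to (n ∷ ns) (inj₁ (inj₁ i)) = ≡.refl
  from∘to (n ∷ ns) (inj₁ (inj₂ x)) = ≡.cong (Sum.map inj₂ suc) (from∘to ns (inj₁ x))
  from∘to (n ∷ ns) (inj₂ zero)     = ≡.refl
  from∘to (n ∷ ns) (inj₂ (suc c))  = ≡.cong (Sum.map inj₂ suc) (from∘to ns (inj₂ c))

blockOf-representatives : ∀ {k} (ns : Vec ℕ k) x →
  blockOf ns (Inverse.to (representatives ns) x) ≡ [ blockOfExtra ns , id ] x
blockOf-representatives (n ∷ ns) (inj₁ (inj₁ i)) = ≡.refl
blockOf-representatives (n ∷ ns) (inj₁ (inj₂ x)) = ≡.cong suc (blockOf-representatives ns (inj₁ x))
blockOf-representatives (n ∷ ns) (inj₂ zero)     = ≡.refl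
blockOf-representatives (n ∷ ns) (inj₂ (suc c))  = ≡.cong suc (blockOf-representatives ns (inj₂ c))

⊎-Fin0 : ∀ {A : Set} → A ↔ (A ⊎ Fin 0)
⊎-Fin0 = mk↔ₛ′ inj₁ [ id , (λ ()) ] [ (λ _ → ≡.refl) , (λ ()) ] (λ _ → ≡.refl)

-- Mirror pairs of the reverse identity.

-- The second copy is listed backwards, so that `inj₁ i` and `inj₂ i` land on positions exchanged by
-- the reverse identity. The detour through `ℓ + 0` comes from the unfolding of `2 * ℓ`.
mirror : ∀ ℓ → (Fin ℓ ⊎ Fin ℓ) ↔ Fin (2 ℕ.* ℓ)
mirror ℓ = ↔-trans (⊎-cong ↔-refl (↔-trans opposite-↔ +0-↔)) (↔-sym Finₚ.+↔⊎)
  where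
  opposite-↔ : Fin ℓ ↔ Fin ℓ
  opposite-↔ = mk↔ₛ′ opposite opposite Finₚ.opposite-involutive Finₚ.opposite-involutive
  +0-↔ : Fin ℓ ↔ Fin (ℓ ℕ.+ 0)
  +0-↔ = ↔-trans ⊎-Fin0 (↔-sym Finₚ.+↔⊎)

toℕ-mirror₁ : ∀ ℓ i → toℕ (Inverse.to (mirror ℓ) (inj₁ i)) ≡ toℕ i
toℕ-mirror₁ ℓ i = Finₚ.toℕ-↑ˡ i (ℓ ℕ.+ 0)

-- Written additively, without truncated subtraction, this is exactly the condition tested by `Rev`
-- for `inj₂ i` and `inj₁ i`.
toℕ-mirror₂ : ∀ ℓ i → suc (toℕ (Inverse.to (mirror ℓ) (inj₂ i)) ℕ.+ toℕ i) ≡ 2 ℕ.* ℓ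
toℕ-mirror₂ ℓ i = begin
  suc (toℕ (ℓ ↑ʳ (opposite i ↑ˡ 0)) ℕ.+ toℕ i)
    ≡⟨ ≡.cong (λ k → suc (k ℕ.+ toℕ i)) (Finₚ.toℕ-↑ʳ ℓ (opposite i ↑ˡ 0)) ⟩
  suc (ℓ ℕ.+ toℕ (opposite i ↑ˡ 0) ℕ.+ toℕ i)
    ≡⟨ ≡.cong (λ k → suc (ℓ ℕ.+ k ℕ.+ toℕ i)) (≡.trans (Finₚ.toℕ-↑ˡ (opposite i) 0) (Finₚ.opposite-prop i)) ⟩
  suc (ℓ ℕ.+ (ℓ ∸ suc (toℕ i)) ℕ.+ toℕ i)
    ≡⟨ ℕₚ.+-suc (ℓ ℕ.+ (ℓ ∸ suc (toℕ i))) (toℕ i) ⟨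
  ℓ ℕ.+ (ℓ ∸ suc (toℕ i)) ℕ.+ suc (toℕ i)
    ≡⟨ ℕₚ.+-assoc ℓ (ℓ ∸ suc (toℕ i)) (suc (toℕ i)) ⟩
  ℓ ℕ.+ (ℓ ∸ suc (toℕ i) ℕ.+ suc (toℕ i))
    ≡⟨ ≡.cong (ℓ ℕ.+_) (≡.trans (ℕₚ.m∸n+n≡m (Finₚ.toℕ<n i)) (≡.sym (ℕₚ.+-identityʳ ℓ))) ⟩
  2 ℕ.* ℓ ∎
  where open ≡.≡-Reasoning

Rev-yes : ∀ {k} {i j : Fin k} → suc (toℕ i ℕ.+ toℕ j) ≡ k → Rev k i j ≡ + 1
Rev-yes {k} {i} {j} eq with suc (toℕ i ℕ.+ toℕ j) ℕ.≟ k
... | yes _ = ≡.refl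
... | no ≢k = contradiction eq ≢k

Rev-no : ∀ {k} {i j : Fin k} → suc (toℕ i ℕ.+ toℕ j) ≢ k → Rev k i j ≡ + 0
Rev-no {k} {i} {j} ≢k with suc (toℕ i ℕ.+ toℕ j) ℕ.≟ k
... | yes eq = contradiction eq ≢k
... | no _   = ≡.refl

Rev-sym : ∀ k i j → Rev k i j ≡ Rev k j i
Rev-sym k i j with suc (toℕ i ℕ.+ toℕ j) ℕ.≟ k
... | yes eq = ≡.sym (Rev-yes (≡.trans (≡.cong suc (ℕₚ.+-comm (toℕ j) (toℕ i))) eq))
... | no ≢k  = ≡.sym (Rev-no (≢k ∘ ≡.trans (≡.cong suc (ℕₚ.+-comm (toℕ i) (toℕ j)))))

-- Two positions in the first half are too small: their sum plus one stays below `2 * ℓ`.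
Rev-mirror₁₁ : ∀ ℓ i j → Rev (2 ℕ.* ℓ) (Inverse.to (mirror ℓ) (inj₁ i)) (Inverse.to (mirror ℓ) (inj₁ j)) ≡ + 0
Rev-mirror₁₁ ℓ i j = Rev-no λ eq → ℕₚ.<-irrefl eq (begin-strict
  suc (toℕ (to (inj₁ i)) ℕ.+ toℕ (to (inj₁ j)))
    ≡⟨ ≡.cong₂ (λ a b → suc (a ℕ.+ b)) (toℕ-mirror₁ ℓ i) (toℕ-mirror₁ ℓ j) ⟩
  suc (toℕ i) ℕ.+ toℕ j  <⟨ ℕₚ.+-mono-≤-< (Finₚ.toℕ<n i) (Finₚ.toℕ<n j) ⟩
  ℓ ℕ.+ ℓ                ≡⟨ ≡.cong (ℓ ℕ.+_) (ℕₚ.+-identityʳ ℓ) ⟨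
  2 ℕ.* ℓ ∎)
  where
  open Inverse (mirror ℓ)
  open ℕₚ.≤-Reasoning

-- The condition tested by `Rev` determines the second position from the first, so a position has
-- only one partner.
Rev-mirror₂₁ : ∀ ℓ i j → i ≢ j → Rev (2 ℕ.* ℓ) (Inverse.to (mirror ℓ) (inj₂ i)) (Inverse.to (mirror ℓ) (inj₁ j)) ≡ + 0
Rev-mirror₂₁ ℓ i j i≢j = Rev-no λ eq → i≢j (Finₚ.toℕ-injective
  (ℕₚ.+-cancelˡ-≡ (toℕ (to (inj₂ i))) (toℕ i) (toℕ j) (ℕₚ.suc-injective (begin
    suc (toℕ (to (inj₂ i)) ℕ.+ toℕ i)               ≡⟨ toℕ-mirror₂ ℓ i ⟩
    2 ℕ.* ℓ                                         ≡⟨ eq ⟨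
    suc (toℕ (to (inj₂ i)) ℕ.+ toℕ (to (inj₁ j)))   ≡⟨ ≡.cong (λ k → suc (toℕ (to (inj₂ i)) ℕ.+ k)) (toℕ-mirror₁ ℓ j) ⟩
    suc (toℕ (to (inj₂ i)) ℕ.+ toℕ j)               ∎))))
  where
  open Inverse (mirror ℓ)
  open ≡.≡-Reasoning

Rev-mirror₂₁-refl : ∀ ℓ i → Rev (2 ℕ.* ℓ) (Inverse.to (mirror ℓ) (inj₂ i)) (Inverse.to (mirror ℓ) (inj₁ i)) ≡ + 1
Rev-mirror₂₁-refl ℓ i = Rev-yes (≡.trans (≡.cong (λ k → suc (toℕ (to (inj₂ i)) ℕ.+ k)) (toℕ-mirror₁ ℓ i)) (toℕ-mirror₂ ℓ i))
  where open Inverse (mirror ℓ)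

toℕ-mirror₂≥ : ∀ ℓ i → ℓ ≤ toℕ (Inverse.to (mirror ℓ) (inj₂ i))
toℕ-mirror₂≥ ℓ i = ≡.subst (ℓ ≤_) (≡.sym (Finₚ.toℕ-↑ʳ ℓ (opposite i ↑ˡ 0))) (ℕₚ.m≤m+n ℓ _)

-- Two positions in the second half are too large: their sum alone already reaches `2 * ℓ`.
Rev-mirror₂₂ : ∀ ℓ i j → Rev (2 ℕ.* ℓ) (Inverse.to (mirror ℓ) (inj₂ i)) (Inverse.to (mirror ℓ) (inj₂ j)) ≡ + 0
Rev-mirror₂₂ ℓ i j = Rev-no λ eq → ℕₚ.<-irrefl (≡.sym eq) (begin-strict
  2 ℕ.* ℓ                                       ≡⟨ ≡.cong (ℓ ℕ.+_) (ℕₚ.+-identityʳ ℓ) ⟩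
  ℓ ℕ.+ ℓ                                       ≤⟨ ℕₚ.+-mono-≤ (toℕ-mirror₂≥ ℓ i) (toℕ-mirror₂≥ ℓ j) ⟩
  toℕ (to (inj₂ i)) ℕ.+ toℕ (to (inj₂ j))       <⟨ ℕₚ.n<1+n _ ⟩
  suc (toℕ (to (inj₂ i)) ℕ.+ toℕ (to (inj₂ j))) ∎)
  where
  open Inverse (mirror ℓ)
  open ℕₚ.≤-Reasoning

-- Quotient determinants for blocks of twins and for mirror pairs.

module Collapse {c r} (R : CommutativeRing c r) where
  open CommutativeRing R hiding (zero)
  open IntegerSolver R
  open Determinant R
  open ShapedDeterminant R
  open import Algebra.Properties.Semiring.Exp semiring using (_^_)
  open import Algebra.Properties.CommutativeMonoid.Sum *-commutativeMonoid using ()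
    renaming (sum to prod; sum-replicate to prod-replicate)
  open import Algebra.Properties.Semiring.Sum semiring using (sum)
  open import Relation.Binary.Reasoning.Setoid setoid

  powers : ∀ {k} → Vec ℕ k → (Fin k → Carrier) → Carrier
  powers []       D = 1#
  powers (n ∷ ns) D = D zero ^ n * powers ns (D ∘ suc)

  prod-extras : ∀ {k} (ns : Vec ℕ k) (D : Fin k → Carrier) →
    prod (D ∘ blockOfExtra ns ∘ Inverse.to (enum (extras ns))) ≈ powers ns D
  prod-extras []       D = refl
  prod-extras (n ∷ ns) D = trans
    (sum-splitAt *-commutativeMonoid n (D ∘ blockOfExtra (n ∷ ns) ∘ Sum.map id (Inverse.to (enum (extras ns)))))
    (*-cong (prod-replicate n) (prod-extras ns (D ∘ suc)))

  sumFin-1 : ∀ n → sumFin R {n} (const 1#) ≡ fromℕ R n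
  sumFin-1 zero    = ≡.refl
  sumFin-1 (suc n) = ≡.cong (λ x → 1# + x) (sumFin-1 n)

  sumFin-splitAt : ∀ m {n} (h : Fin m ⊎ Fin n → Carrier) →
    sumFin R (h ∘ splitAt m) ≈ sumFin R (h ∘ inj₁) + sumFin R (h ∘ inj₂)
  sumFin-splitAt m h = begin
    sumFin R (h ∘ splitAt m)                     ≡⟨ sumFin≡sum (h ∘ splitAt m) ⟩
    sum (h ∘ splitAt m)                          ≈⟨ sum-splitAt +-commutativeMonoid m h ⟩
    sum (h ∘ inj₁) + sum (h ∘ inj₂)              ≡⟨ ≡.cong₂ _+_ (sumFin≡sum (h ∘ inj₁)) (sumFin≡sum (h ∘ inj₂)) ⟨
    sumFin R (h ∘ inj₁) + sumFin R (h ∘ inj₂)    ∎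

  count-extras : ∀ {k} (ns : Vec ℕ k) x →
    sumFin R (λ i → δᶠ x (blockOfExtra ns (Inverse.to (enum (extras ns)) i))) ≈ fromℕ R (lookup ns x)
  count-extras (n ∷ ns) x = trans
    (sumFin-splitAt n (δᶠ x ∘ blockOfExtra (n ∷ ns) ∘ Sum.map id (Inverse.to (enum (extras ns)))))
    (count x)
    where
    count : ∀ x → sumFin R {n} (λ _ → δᶠ x zero) +
      sumFin R (λ i → δᶠ x (suc (blockOfExtra ns (Inverse.to (enum (extras ns)) i)))) ≈ fromℕ R (lookup (n ∷ ns) x)
    count zero    = trans (+-cong (reflexive (sumFin-1 n)) (sumFin-0 {size (extras ns)} λ i → refl)) (+-identityʳ _)
    count (suc x) = trans (+-cong (sumFin-0 {n} λ i → refl) (count-extras ns x)) (+-identityˡ _)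

  -- In the quotient matrix each block is represented by one of its columns
  -- and by the sum of its rows.
  DET-blocks : ∀ {k} (ns : Vec ℕ k) (D : Fin k → Carrier) (B : Mat k) →
    DET (blocks ns) (λ x y → D (blockOf ns x) * δˢ x y + B (blockOf ns x) (blockOf ns y)) ≈
    powers ns D * det R (λ x y → D x * δᶠ x y + fromℕ R (suc (lookup ns x)) * B x y)
  DET-blocks {k} ns D B = begin
    DET (blocks ns) M
      ≈⟨ DET-reindex (fin p ⊞ fin k) (blocks ns) φ M ⟨
    DET (fin p ⊞ fin k) (λ x y → M (Φ.to x) (Φ.to y))
      ≈⟨ DET-cong (fin p ⊞ fin k) (λ x y → +-cong
           (*-cong (reflexive (≡.cong D (cl-φ x))) (reflexive (δ-injective _≟ˢ_ _≟ˢ_ Φ.to (↔-injective φ) x y)))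
           (reflexive (≡.cong₂ B (cl-φ x) (cl-φ y)))) ⟩
    DET (fin p ⊞ fin k) N
      ≈⟨ DET-merge p (fin k) f (D ∘ f) N H₁ H₂ ⟩
    prod (D ∘ f) * det R (λ x y → N (inj₂ x) (inj₂ y) + sumFin R (λ i → δᶠ x (f i) * N (inj₁ i) (inj₂ y)))
      ≈⟨ *-cong (prod-extras ns D) (det-cong entry) ⟩
    powers ns D * det R (λ x y → D x * δᶠ x y + fromℕ R (suc (lookup ns x)) * B x y) ∎
    where
    M : El (blocks ns) → El (blocks ns) → Carrier
    M x y = D (blockOf ns x) * δˢ x y + B (blockOf ns x) (blockOf ns y)
    p = size (extras ns)
    e = enum (extras ns)
    φ : El (fin p ⊞ fin k) ↔ El (blocks ns)
    φ = ↔-trans (⊎-cong e ↔-refl) (representatives ns)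
    module Φ = Inverse φ
    f : Fin p → Fin k
    f = blockOfExtra ns ∘ Inverse.to e
    cl : Fin p ⊎ Fin k → Fin k
    cl = [ f , id ]
    cl-φ : ∀ x → blockOf ns (Φ.to x) ≡ cl x
    cl-φ (inj₁ i) = blockOf-representatives ns (inj₁ (Inverse.to e i))
    cl-φ (inj₂ x) = blockOf-representatives ns (inj₂ x)
    N : El (fin p ⊞ fin k) → El (fin p ⊞ fin k) → Carrier
    N x y = D (cl x) * δˢ {fin p ⊞ fin k} x y + B (cl x) (cl y)
    H₁ : ∀ i j → N (inj₁ j) (inj₁ i) ≈ N (inj₁ j) (inj₂ (f i)) + D (f i) * δᶠ j i
    H₁ i j = begin
      D (f j) * δᶠ j i + B (f j) (f i)                       ≈⟨ +-congʳ (δ-subst Finₚ._≟_ (D ∘ f) j i) ⟩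
      D (f i) * δᶠ j i + B (f j) (f i)
        ≈⟨ solve 3 (λ x b d → x :+ b := d :* con (+ 0) :+ b :+ x) refl _ _ (D (f j)) ⟩
      D (f j) * 0# + B (f j) (f i) + D (f i) * δᶠ j i        ∎
    H₂ : ∀ i x → N (inj₂ x) (inj₁ i) + D (f i) * δᶠ x (f i) ≈ N (inj₂ x) (inj₂ (f i))
    H₂ i x = begin
      D x * 0# + B x (f i) + D (f i) * δᶠ x (f i)            ≈⟨ +-congˡ (δ-subst Finₚ._≟_ D x (f i)) ⟨
      D x * 0# + B x (f i) + D x * δᶠ x (f i)
        ≈⟨ solve 3 (λ d b x → d :* con (+ 0) :+ b :+ x := x :+ b) refl _ _ _ ⟩
      D x * δᶠ x (f i) + B x (f i)                           ∎
    entry : ∀ x y → N (inj₂ x) (inj₂ y) + sumFin R (λ i → δᶠ x (f i) * N (inj₁ i) (inj₂ y)) ≈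
                    D x * δᶠ x y + fromℕ R (suc (lookup ns x)) * B x y
    -- The representative and each of its `lookup ns x` extras contribute one copy of `B x y`. The
    -- diagonal terms `D (f i)` of the extras sit in deleted columns and do not appear in the sum.
    entry x y = begin
      D x * δᶠ x y + B x y + sumFin R (λ i → δᶠ x (f i) * (D (f i) * 0# + B (f i) y))
        ≈⟨ +-congˡ (sumFin-cong λ i → trans
             (solve 3 (λ e d b → e :* (d :* con (+ 0) :+ b) := b :* e) refl (δᶠ x (f i)) (D (f i)) (B (f i) y))
             (sym (δ-subst Finₚ._≟_ (λ z → B z y) x (f i)))) ⟩
      D x * δᶠ x y + B x y + sumFin R (λ i → B x y * δᶠ x (f i))
        ≈⟨ +-congˡ (trans (sumFin-* (B x y) (δᶠ x ∘ f)) (*-congˡ (count-extras ns x))) ⟩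
      D x * δᶠ x y + B x y + B x y * fromℕ R (lookup ns x)
        ≈⟨ solve 3 (λ d b n → d :+ b :+ b :* n := d :+ (con (+ 1) :+ n) :* b) refl _ _ _ ⟩
      D x * δᶠ x y + fromℕ R (suc (lookup ns x)) * B x y ∎

  -- The off-diagonal blocks do not depend on the index in `T`: vertices of `T` look alike from `S`,
  -- so whether two of them are twins is decided by `Y` alone.
  bordered : ∀ {S T : Set} → (S → S → Carrier) → (S → Carrier) → (S → Carrier) → (T → T → Carrier) →
             S ⊎ T → S ⊎ T → Carrier
  bordered X u w Y (inj₁ x) (inj₁ y) = X x y
  bordered X u w Y (inj₁ x) (inj₂ _) = u x
  bordered X u w Y (inj₂ _) (inj₁ y) = w y
  bordered X u w Y (inj₂ x) (inj₂ y) = Y x y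

  rev : ∀ k → Mat k
  rev k i j = fromℤ R (Rev k i j)

  fromℤ-1 : fromℤ R (+ 1) ≈ 1#
  fromℤ-1 = +-identityʳ 1#

  antidiagonal : ∀ {n} → Fin n ⊎ Fin n → Fin n ⊎ Fin n → Carrier
  antidiagonal (inj₁ _) (inj₁ _) = 0#
  antidiagonal (inj₁ i) (inj₂ j) = δᶠ i j
  antidiagonal (inj₂ i) (inj₁ j) = δᶠ i j
  antidiagonal (inj₂ _) (inj₂ _) = 0#

  δ-sym : ∀ {I : Set} (_≟_ : DecidableEquality I) x y → δ _≟_ x y ≡ δ _≟_ y x
  δ-sym _≟_ x y with x ≟ y
  ... | yes ≡.refl = ≡.sym (δ-refl _≟_ x)
  ... | no x≢y     = ≡.sym (δ-≢ _≟_ (x≢y ∘ ≡.sym))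

  rev-mirror : ∀ ℓ x y → rev (2 ℕ.* ℓ) (Inverse.to (mirror ℓ) x) (Inverse.to (mirror ℓ) y) ≈ antidiagonal x y
  rev-mirror ℓ (inj₁ i) (inj₁ j) = reflexive (≡.cong (fromℤ R) (Rev-mirror₁₁ ℓ i j))
  rev-mirror ℓ (inj₂ i) (inj₂ j) = reflexive (≡.cong (fromℤ R) (Rev-mirror₂₂ ℓ i j))
  rev-mirror ℓ (inj₂ i) (inj₁ j) with i Finₚ.≟ j
  ... | yes ≡.refl = trans (reflexive (≡.cong (fromℤ R) (Rev-mirror₂₁-refl ℓ i))) fromℤ-1
  ... | no i≢j     = reflexive (≡.cong (fromℤ R) (Rev-mirror₂₁ ℓ i j i≢j))
  rev-mirror ℓ (inj₁ i) (inj₂ j) = begin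
    rev (2 ℕ.* ℓ) (to (inj₁ i)) (to (inj₂ j))  ≡⟨ ≡.cong (fromℤ R) (Rev-sym (2 ℕ.* ℓ) (to (inj₁ i)) (to (inj₂ j))) ⟩
    rev (2 ℕ.* ℓ) (to (inj₂ j)) (to (inj₁ i))  ≈⟨ rev-mirror ℓ (inj₂ j) (inj₁ i) ⟩
    δᶠ j i                                     ≡⟨ δ-sym Finₚ._≟_ j i ⟩
    δᶠ i j                                     ∎
    where open Inverse (mirror ℓ)

  sumFin-δ : ∀ {n} x (g : Fin n → Carrier) → sumFin R (λ i → δᶠ x i * g i) ≈ g x
  sumFin-δ {suc n} zero    g = trans (+-cong (*-identityˡ _) (sumFin-0 λ i → zeroˡ (g (suc i)))) (+-identityʳ _)
  sumFin-δ {suc n} (suc x) g = trans (+-cong (zeroˡ (g zero)) (sumFin-δ x (g ∘ suc))) (+-identityˡ _)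

  -- In `p I + q R` the columns of a mirror pair differ by `p - q` times the difference of the two
  -- unit vectors, which yields one factor per pair. Adding the two rows of a pair doubles `w` and
  -- leaves `p + q` on the diagonal; `u` is kept, since columns are not added.
  DET-rev : ∀ s ℓ (X : El s → El s → Carrier) (u w : El s → Carrier) p q →
    DET (s ⊞ fin (2 ℕ.* ℓ)) (bordered X u w (λ i j → p * δᶠ i j + q * rev (2 ℕ.* ℓ) i j)) ≈
    (p - q) ^ ℓ * DET (s ⊞ fin ℓ) (bordered X u (λ x → w x + w x) (λ i j → (p + q) * δᶠ i j))
  DET-rev s ℓ X u w p q = begin
    DET (s ⊞ fin (2 ℕ.* ℓ)) M
      ≈⟨ DET-reindex (fin ℓ ⊞ (s ⊞ fin ℓ)) (s ⊞ fin (2 ℕ.* ℓ)) φ M ⟨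
    DET (fin ℓ ⊞ (s ⊞ fin ℓ)) (λ x y → M (Φ.to x) (Φ.to y))
      ≈⟨ DET-cong (fin ℓ ⊞ (s ⊞ fin ℓ)) (λ x y → M-N (Inverse.to ψ x) (Inverse.to ψ y)) ⟩
    DET (fin ℓ ⊞ (s ⊞ fin ℓ)) (λ x y → N (Inverse.to ψ x) (Inverse.to ψ y))
      ≈⟨ DET-merge ℓ (s ⊞ fin ℓ) inj₂ (const (p - q)) (λ x y → N (Inverse.to ψ x) (Inverse.to ψ y)) H₁ H₂ ⟩
    prod {ℓ} (const (p - q)) * DET (s ⊞ fin ℓ) N′
      ≈⟨ *-cong (prod-replicate ℓ) (DET-cong (s ⊞ fin ℓ) entry) ⟩
    (p - q) ^ ℓ * DET (s ⊞ fin ℓ) (bordered X u (λ x → w x + w x) (λ i j → (p + q) * δᶠ i j)) ∎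
    where
    M : El (s ⊞ fin (2 ℕ.* ℓ)) → El (s ⊞ fin (2 ℕ.* ℓ)) → Carrier
    M = bordered X u w (λ i j → p * δᶠ i j + q * rev (2 ℕ.* ℓ) i j)
    N : El (s ⊞ (fin ℓ ⊞ fin ℓ)) → El (s ⊞ (fin ℓ ⊞ fin ℓ)) → Carrier
    N = bordered X u w (λ x y → p * δˢ {fin ℓ ⊞ fin ℓ} x y + q * antidiagonal x y)
    -- Moves the first member of every pair to the front, where `DET-merge` expects the vertices to
    -- be absorbed.
    ψ : El (fin ℓ ⊞ (s ⊞ fin ℓ)) ↔ El (s ⊞ (fin ℓ ⊞ fin ℓ))
    ψ = mk↔ₛ′
      [ inj₂ ∘ inj₁ , [ inj₁ , inj₂ ∘ inj₂ ] ]
      [ inj₂ ∘ inj₁ , [ inj₁ , inj₂ ∘ inj₂ ] ]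
      (λ { (inj₁ _) → ≡.refl ; (inj₂ (inj₁ _)) → ≡.refl ; (inj₂ (inj₂ _)) → ≡.refl })
      (λ { (inj₁ _) → ≡.refl ; (inj₂ (inj₁ _)) → ≡.refl ; (inj₂ (inj₂ _)) → ≡.refl })
    φ : El (fin ℓ ⊞ (s ⊞ fin ℓ)) ↔ El (s ⊞ fin (2 ℕ.* ℓ))
    φ = ↔-trans ψ (⊎-cong ↔-refl (mirror ℓ))
    module Φ = Inverse φ
    M-N : ∀ x y → M (Sum.map id (Inverse.to (mirror ℓ)) x) (Sum.map id (Inverse.to (mirror ℓ)) y) ≈ N x y
    M-N (inj₁ _) (inj₁ _) = refl
    M-N (inj₁ _) (inj₂ _) = refl
    M-N (inj₂ _) (inj₁ _) = refl
    M-N (inj₂ x) (inj₂ y) = +-cong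
      (*-congˡ (reflexive (δ-injective _≟ˢ_ Finₚ._≟_ (Inverse.to (mirror ℓ)) (↔-injective (mirror ℓ)) x y)))
      (*-congˡ (rev-mirror ℓ x y))
    N∘ψ : El (fin ℓ ⊞ (s ⊞ fin ℓ)) → El (fin ℓ ⊞ (s ⊞ fin ℓ)) → Carrier
    N∘ψ x y = N (Inverse.to ψ x) (Inverse.to ψ y)
    N′ : El (s ⊞ fin ℓ) → El (s ⊞ fin ℓ) → Carrier
    N′ x y = N∘ψ (inj₂ x) (inj₂ y) + sumFin R (λ i → δˢ {s ⊞ fin ℓ} x (inj₂ i) * N∘ψ (inj₁ i) (inj₂ y))
    H₁ : ∀ i j → N∘ψ (inj₁ j) (inj₁ i) ≈ N∘ψ (inj₁ j) (inj₂ (inj₂ i)) + (p - q) * δᶠ j i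
    H₁ i j = solve 3 (λ p q d → p :* d :+ q :* con (+ 0) := p :* con (+ 0) :+ q :* d :+ (p :- q) :* d) refl p q (δᶠ j i)
    H₂ : ∀ i x → N∘ψ (inj₂ x) (inj₁ i) + (p - q) * δˢ {s ⊞ fin ℓ} x (inj₂ i) ≈ N∘ψ (inj₂ x) (inj₂ (inj₂ i))
    H₂ i (inj₁ x) = trans (+-congˡ (zeroʳ _)) (+-identityʳ _)
    H₂ i (inj₂ j) = solve 3 (λ p q d → p :* con (+ 0) :+ q :* d :+ (p :- q) :* d := p :* d :+ q :* con (+ 0)) refl p q (δᶠ j i)
    entry : ∀ x y → N′ x y ≈ bordered X u (λ x → w x + w x) (λ i j → (p + q) * δᶠ i j) x y
    entry (inj₁ x) (inj₁ y) = trans (+-congˡ (sumFin-0 {ℓ} λ i → zeroˡ (w y))) (+-identityʳ _)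
    entry (inj₁ x) (inj₂ k) = trans (+-congˡ (sumFin-0 λ i → zeroˡ (p * 0# + q * δᶠ i k))) (+-identityʳ _)
    entry (inj₂ j) (inj₁ y) = +-congˡ (sumFin-δ j (const (w y)))
    entry (inj₂ j) (inj₂ k) = trans
      (+-congˡ (sumFin-δ j (λ i → p * 0# + q * δᶠ i k)))
      (solve 3 (λ p q d → p :* d :+ q :* con (+ 0) :+ (p :* con (+ 0) :+ q :* d) := (p :+ q) :* d) refl p q (δᶠ j k))

-- Signed adjacency matrices.

Trit : ℤ → Set
Trit z = (z ≡ + 0) ⊎ ((z ≡ + 1) ⊎ (z ≡ -[1+ 0 ]))

trit? : ∀ z → Dec (Trit z)
trit? z = (z ℤₚ.≟ + 0) ⊎-dec ((z ℤₚ.≟ + 1) ⊎-dec (z ℤₚ.≟ -[1+ 0 ]))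

trit-neg : ∀ {z} → Trit z → Trit (ℤ.- z)
trit-neg (inj₁ ≡.refl)        = inj₁ ≡.refl
trit-neg (inj₂ (inj₁ ≡.refl)) = inj₂ (inj₂ ≡.refl)
trit-neg (inj₂ (inj₂ ≡.refl)) = inj₂ (inj₁ ≡.refl)

SignedAdjacency : ∀ {X : Set} → (X → X → ℤ) → Set
SignedAdjacency N = (∀ x y → N x y ≡ N y x) × (∀ x → N x x ≡ + 0) × (∀ x y → Trit (N x y))

signedAdjacency-pullback : ∀ {n} {X : Set} {A : Matrix n} (N : X → X → ℤ) (f : Fin n → X) →
  (∀ i j → A i j ≡ N (f i) (f j)) → SignedAdjacency N → IsSignedAdjacency A
signedAdjacency-pullback N f A≡N (N-sym , N-diag , N-trit) =
  (λ i j → ≡.trans (A≡N i j) (≡.trans (N-sym (f i) (f j)) (≡.sym (A≡N j i)))) ,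
  (λ i → ≡.trans (A≡N i i) (N-diag (f i))) ,
  (λ i j → ≡.subst Trit (≡.sym (A≡N i j)) (N-trit (f i) (f j)))

-- Each class `a` becomes a set of twins, any two of which are joined with sign `β a a` (not joined
-- when it is 0). Thus `J - I` and `R₂` are classes with diagonal value 1, and their negatives
-- classes with -1.
blowup : ∀ {k} (ns : Vec ℕ k) → (Fin k → Fin k → ℤ) → El (blocks ns) → El (blocks ns) → ℤ
blowup ns β x y = if does (x ≟ˢ y) then + 0 else β (blockOf ns x) (blockOf ns y)

blowup-signed : ∀ {k} (ns : Vec ℕ k) (β : Fin k → Fin k → ℤ) →
  (∀ a b → β a b ≡ β b a) → (∀ a b → Trit (β a b)) → SignedAdjacency (blowup ns β)
blowup-signed ns β β-sym β-trit = symmetric , diagonal , trit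
  where
  symmetric : ∀ x y → blowup ns β x y ≡ blowup ns β y x
  symmetric x y with x ≟ˢ y | y ≟ˢ x
  ... | yes _   | yes _   = ≡.refl
  ... | yes x≡y | no y≢x  = contradiction (≡.sym x≡y) y≢x
  ... | no x≢y  | yes y≡x = contradiction (≡.sym y≡x) x≢y
  ... | no _    | no _    = β-sym (blockOf ns x) (blockOf ns y)
  diagonal : ∀ x → blowup ns β x x ≡ + 0
  diagonal x with x ≟ˢ x
  ... | yes _   = ≡.refl
  ... | no x≢x = contradiction ≡.refl x≢x
  trit : ∀ x y → Trit (blowup ns β x y)
  trit x y with x ≟ˢ y
  ... | yes _ = inj₁ ≡.refl
  ... | no _  = β-trit (blockOf ns x) (blockOf ns y)

J⊝I-entry : ∀ {n} (i j : Fin n) → (J ⊝ I n) i j ≡ (if does (i Finₚ.≟ j) then + 0 else + 1)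
J⊝I-entry i j with i Finₚ.≟ j
... | yes _ = ≡.refl
... | no _  = ≡.refl

I⊝J-entry : ∀ {n} (i j : Fin n) → (I n ⊝ J) i j ≡ (if does (i Finₚ.≟ j) then + 0 else -[1+ 0 ])
I⊝J-entry i j with i Finₚ.≟ j
... | yes _ = ≡.refl
... | no _  = ≡.refl

O-entry : ∀ {n} (i j : Fin n) → O i j ≡ (if does (i Finₚ.≟ j) then + 0 else + 0)
O-entry i j with i Finₚ.≟ j
... | yes _ = ≡.refl
... | no _  = ≡.refl

Rev₂-entry : ∀ (i j : Fin 2) → Rev 2 i j ≡ (if does (i Finₚ.≟ j) then + 0 else + 1)
Rev₂-entry zero       zero       = ≡.refl
Rev₂-entry zero       (suc zero) = ≡.refl
Rev₂-entry (suc zero) zero       = ≡.refl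
Rev₂-entry (suc zero) (suc zero) = ≡.refl

⊖Rev₂-entry : ∀ (i j : Fin 2) → (⊖ Rev 2) i j ≡ (if does (i Finₚ.≟ j) then + 0 else -[1+ 0 ])
⊖Rev₂-entry zero       zero       = ≡.refl
⊖Rev₂-entry zero       (suc zero) = ≡.refl
⊖Rev₂-entry (suc zero) zero       = ≡.refl
⊖Rev₂-entry (suc zero) (suc zero) = ≡.refl

J⊝I-signed : ∀ n → SignedAdjacency (J {n} {n} ⊝ I n)
J⊝I-signed n = symmetric , diagonal , trit
  where
  symmetric : ∀ i j → (J ⊝ I n) i j ≡ (J ⊝ I n) j i
  symmetric i j with i Finₚ.≟ j | j Finₚ.≟ i
  ... | yes _   | yes _   = ≡.refl
  ... | yes i≡j | no j≢i  = contradiction (≡.sym i≡j) j≢i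
  ... | no i≢j  | yes j≡i = contradiction (≡.sym j≡i) i≢j
  ... | no _    | no _    = ≡.refl
  diagonal : ∀ i → (J ⊝ I n) i i ≡ + 0
  diagonal i with i Finₚ.≟ i
  ... | yes _   = ≡.refl
  ... | no i≢i = contradiction ≡.refl i≢i
  trit : ∀ i j → Trit ((J ⊝ I n) i j)
  trit i j with i Finₚ.≟ j
  ... | yes _ = inj₁ ≡.refl
  ... | no _  = inj₂ (inj₁ ≡.refl)

-- The zero diagonal is a matter of parity: a diagonal entry of `Rev` is 1 only if an odd number
-- `2 i + 1` equals the order, which here is even.
Rev-signed : ∀ ℓ → SignedAdjacency (Rev (2 ℕ.* ℓ))
Rev-signed ℓ = Rev-sym (2 ℕ.* ℓ) , (λ i → Rev-no (odd≢even (toℕ i) ℓ)) , trit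
  where
  odd≢even : ∀ a b → suc (a ℕ.+ a) ≢ 2 ℕ.* b
  odd≢even a b eq = ℕₚ.even≢odd b a (≡.trans (≡.sym eq) (≡.cong (λ x → suc (a ℕ.+ x)) (≡.sym (ℕₚ.+-identityʳ a))))
  trit : ∀ i j → Trit (Rev (2 ℕ.* ℓ) i j)
  trit i j with suc (toℕ i ℕ.+ toℕ j) ℕ.≟ 2 ℕ.* ℓ
  ... | yes _ = inj₂ (inj₁ ≡.refl)
  ... | no _  = inj₁ ≡.refl

⊖-signed : ∀ {n} {A : Matrix n} → SignedAdjacency A → SignedAdjacency (⊖ A)
⊖-signed (A-sym , A-diag , A-trit) =
  (λ i j → ≡.cong ℤ.-_ (A-sym i j)) , (λ i → ≡.cong ℤ.-_ (A-diag i)) , (λ i j → trit-neg (A-trit i j))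

joined : ∀ {a b} → Matrix a → Matrix b → Fin a ⊎ Fin b → Fin a ⊎ Fin b → ℤ
joined A D (inj₁ i) (inj₁ j) = A i j
joined A D (inj₁ _) (inj₂ _) = + 1
joined A D (inj₂ _) (inj₁ _) = + 1
joined A D (inj₂ i) (inj₂ j) = D i j

block2-joined : ∀ {a b} (A : Matrix a) (D : Matrix b) i j →
  block2 A J J D i j ≡ joined A D (splitAt a i) (splitAt a j)
block2-joined {a} A D i j with splitAt a i | splitAt a j
... | inj₁ _ | inj₁ _ = ≡.refl
... | inj₁ _ | inj₂ _ = ≡.refl
... | inj₂ _ | inj₁ _ = ≡.refl
... | inj₂ _ | inj₂ _ = ≡.refl

joined-signed : ∀ {a b} {A : Matrix a} {D : Matrix b} →
  SignedAdjacency A → SignedAdjacency D → SignedAdjacency (joined A D)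
joined-signed {A = A} {D} (A-sym , A-diag , A-trit) (D-sym , D-diag , D-trit) = symmetric , [ A-diag , D-diag ] , trit
  where
  symmetric : ∀ x y → joined A D x y ≡ joined A D y x
  symmetric (inj₁ i) (inj₁ j) = A-sym i j
  symmetric (inj₁ _) (inj₂ _) = ≡.refl
  symmetric (inj₂ _) (inj₁ _) = ≡.refl
  symmetric (inj₂ i) (inj₂ j) = D-sym i j
  trit : ∀ x y → Trit (joined A D x y)
  trit (inj₁ i) (inj₁ j) = A-trit i j
  trit (inj₁ _) (inj₂ _) = inj₂ (inj₁ ≡.refl)
  trit (inj₂ _) (inj₁ _) = inj₂ (inj₁ ≡.refl)
  trit (inj₂ i) (inj₂ j) = D-trit i j

block2-signed : ∀ {a b} {A : Matrix a} {D : Matrix b} →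
  SignedAdjacency A → SignedAdjacency D → IsSignedAdjacency (block2 A J J D)
block2-signed {a} {A = A} {D} SA SD =
  signedAdjacency-pullback (joined A D) (splitAt a) (block2-joined A D) (joined-signed SA SD)

-- The four-block matrices as blow-ups.

-- The trailing `Fin 0` makes the target coincide with the index set of a four-element `blocks`
-- list, whose recursion ends in `fin 0`.
view₄ : ∀ a b c d →
  Fin (a ℕ.+ (b ℕ.+ (c ℕ.+ d))) ↔ (Fin a ⊎ (Fin b ⊎ (Fin c ⊎ (Fin d ⊎ Fin 0))))
view₄ a b c d = ↔-trans Finₚ.+↔⊎ (⊎-cong ↔-refl (↔-trans Finₚ.+↔⊎ (⊎-cong ↔-refl
  (↔-trans Finₚ.+↔⊎ (⊎-cong ↔-refl ⊎-Fin0)))))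

cases₄ : ∀ {a b c d} → (Fin a → ℤ) → (Fin b → ℤ) → (Fin c → ℤ) → (Fin d → ℤ) →
  Fin a ⊎ (Fin b ⊎ (Fin c ⊎ (Fin d ⊎ Fin 0))) → ℤ
cases₄ f g h k (inj₁ x)                      = f x
cases₄ f g h k (inj₂ (inj₁ x))               = g x
cases₄ f g h k (inj₂ (inj₂ (inj₁ x)))        = h x
cases₄ f g h k (inj₂ (inj₂ (inj₂ (inj₁ x)))) = k x

row4-cases : ∀ {p} a b c d (X₁ : Block p a) (X₂ : Block p b) (X₃ : Block p c) (X₄ : Block p d) i j →
  row4 a b c d X₁ X₂ X₃ X₄ i j ≡ cases₄ (X₁ i) (X₂ i) (X₃ i) (X₄ i) (Inverse.to (view₄ a b c d) j)
row4-cases a b c d X₁ X₂ X₃ X₄ i j with splitAt a j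
... | inj₁ _ = ≡.refl
... | inj₂ j′ with splitAt b j′
...   | inj₁ _ = ≡.refl
...   | inj₂ j″ with splitAt c j″
...     | inj₁ _ = ≡.refl
...     | inj₂ _ = ≡.refl

block4-cases : ∀ a b c d R₁ R₂ R₃ R₄ i j → block4 a b c d R₁ R₂ R₃ R₄ i j ≡
  cases₄ (flip R₁ j) (flip R₂ j) (flip R₃ j) (flip R₄ j) (Inverse.to (view₄ a b c d) i)
block4-cases a b c d R₁ R₂ R₃ R₄ i j with splitAt a i
... | inj₁ _ = ≡.refl
... | inj₂ i′ with splitAt b i′
...   | inj₁ _ = ≡.refl
...   | inj₂ i″ with splitAt c i″
...     | inj₁ _ = ≡.refl
...     | inj₂ _ = ≡.refl

table : ∀ {k} → Vec (Vec ℤ k) k → Fin k → Fin k → ℤ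
table v a b = lookup (lookup v a) b

-- Diagonal entries are the signs inside the blocks. The two middle blocks of `A₃` are single
-- vertices and get 0; those of `A₄` are `R₂` and its negative, that is, `J - I` of order 2 up to
-- sign.
β₃ β₄ : Fin 4 → Fin 4 → ℤ
β₃ = table
  ( (+ 1 ∷ + 1      ∷ + 1 ∷ + 0      ∷ [])
  ∷ (+ 1 ∷ + 0      ∷ + 1 ∷ -[1+ 0 ] ∷ [])
  ∷ (+ 1 ∷ + 1      ∷ + 0 ∷ + 1      ∷ [])
  ∷ (+ 0 ∷ -[1+ 0 ] ∷ + 1 ∷ -[1+ 0 ] ∷ []) ∷ [])
β₄ = table
  ( (+ 1 ∷ + 1 ∷ + 0      ∷ + 1      ∷ [])
  ∷ (+ 1 ∷ + 1 ∷ + 0      ∷ + 0      ∷ [])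
  ∷ (+ 0 ∷ + 0 ∷ -[1+ 0 ] ∷ -[1+ 0 ] ∷ [])
  ∷ (+ 1 ∷ + 0 ∷ -[1+ 0 ] ∷ -[1+ 0 ] ∷ []) ∷ [])

A₃-blowup : ∀ m ℓ i j → let open Inverse (view₄ (suc m) 1 1 (suc ℓ)) in
  A₃ (suc m) (suc ℓ) i j ≡ blowup (m ∷ 0 ∷ 0 ∷ ℓ ∷ []) β₃ (to i) (to j)
A₃-blowup m ℓ i j = ≡.trans
  (block4-cases (suc m) 1 1 (suc ℓ) (row (J ⊝ I _) J J O) (row J O J (⊖ J)) (row J J O J) (row O (⊖ J) J (I _ ⊝ J)) i j)
  (rows (to i))
  where
  open Inverse (view₄ (suc m) 1 1 (suc ℓ))
  row : ∀ {p} → Block p (suc m) → Block p 1 → Block p 1 → Block p (suc ℓ) → Block p _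
  row = row4 (suc m) 1 1 (suc ℓ)
  N = blowup (m ∷ 0 ∷ 0 ∷ ℓ ∷ []) β₃
  via : ∀ {p} (X₁ : Block p (suc m)) (X₂ : Block p 1) (X₃ : Block p 1) (X₄ : Block p (suc ℓ)) i x →
        (∀ y → cases₄ (X₁ i) (X₂ i) (X₃ i) (X₄ i) y ≡ N x y) → row X₁ X₂ X₃ X₄ i j ≡ N x (to j)
  via X₁ X₂ X₃ X₄ i x eq = ≡.trans (row4-cases (suc m) 1 1 (suc ℓ) X₁ X₂ X₃ X₄ i j) (eq (to j))
  rows : ∀ x → cases₄ _ _ _ _ x ≡ N x (to j)
  rows (inj₁ i) = via (J ⊝ I _) J J O i (inj₁ i) λ where
    (inj₁ j)                      → J⊝I-entry i j
    (inj₂ (inj₁ _))               → ≡.refl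
    (inj₂ (inj₂ (inj₁ _)))        → ≡.refl
    (inj₂ (inj₂ (inj₂ (inj₁ _)))) → ≡.refl
  rows (inj₂ (inj₁ i)) = via J O J (⊖ J) i (inj₂ (inj₁ i)) λ where
    (inj₁ _)                      → ≡.refl
    (inj₂ (inj₁ j))               → O-entry i j
    (inj₂ (inj₂ (inj₁ _)))        → ≡.refl
    (inj₂ (inj₂ (inj₂ (inj₁ _)))) → ≡.refl
  rows (inj₂ (inj₂ (inj₁ i))) = via J J O J i (inj₂ (inj₂ (inj₁ i))) λ where
    (inj₁ _)                      → ≡.refl
    (inj₂ (inj₁ _))               → ≡.refl
    (inj₂ (inj₂ (inj₁ j)))        → O-entry i j
    (inj₂ (inj₂ (inj₂ (inj₁ _)))) → ≡.refl
  rows (inj₂ (inj₂ (inj₂ (inj₁ i)))) = via O (⊖ J) J (I _ ⊝ J) i (inj₂ (inj₂ (inj₂ (inj₁ i)))) λ where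
    (inj₁ _)                      → ≡.refl
    (inj₂ (inj₁ _))               → ≡.refl
    (inj₂ (inj₂ (inj₁ _)))        → ≡.refl
    (inj₂ (inj₂ (inj₂ (inj₁ j)))) → I⊝J-entry i j

A₄-blowup : ∀ m ℓ i j → let open Inverse (view₄ (suc m) 2 2 (suc ℓ)) in
  A₄ (suc m) (suc ℓ) i j ≡ blowup (m ∷ 1 ∷ 1 ∷ ℓ ∷ []) β₄ (to i) (to j)
A₄-blowup m ℓ i j = ≡.trans
  (block4-cases (suc m) 2 2 (suc ℓ) (row (J ⊝ I _) J O J) (row J (Rev 2) O O) (row O O (⊖ Rev 2) (⊖ J)) (row J O (⊖ J) (I _ ⊝ J)) i j)
  (rows (to i))
  where
  open Inverse (view₄ (suc m) 2 2 (suc ℓ))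
  row : ∀ {p} → Block p (suc m) → Block p 2 → Block p 2 → Block p (suc ℓ) → Block p _
  row = row4 (suc m) 2 2 (suc ℓ)
  N = blowup (m ∷ 1 ∷ 1 ∷ ℓ ∷ []) β₄
  via : ∀ {p} (X₁ : Block p (suc m)) (X₂ : Block p 2) (X₃ : Block p 2) (X₄ : Block p (suc ℓ)) i x →
        (∀ y → cases₄ (X₁ i) (X₂ i) (X₃ i) (X₄ i) y ≡ N x y) → row X₁ X₂ X₃ X₄ i j ≡ N x (to j)
  via X₁ X₂ X₃ X₄ i x eq = ≡.trans (row4-cases (suc m) 2 2 (suc ℓ) X₁ X₂ X₃ X₄ i j) (eq (to j))
  rows : ∀ x → cases₄ _ _ _ _ x ≡ N x (to j)
  rows (inj₁ i) = via (J ⊝ I _) J O J i (inj₁ i) λ where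
    (inj₁ j)                      → J⊝I-entry i j
    (inj₂ (inj₁ _))               → ≡.refl
    (inj₂ (inj₂ (inj₁ _)))        → ≡.refl
    (inj₂ (inj₂ (inj₂ (inj₁ _)))) → ≡.refl
  rows (inj₂ (inj₁ i)) = via J (Rev 2) O O i (inj₂ (inj₁ i)) λ where
    (inj₁ _)                      → ≡.refl
    (inj₂ (inj₁ j))               → Rev₂-entry i j
    (inj₂ (inj₂ (inj₁ _)))        → ≡.refl
    (inj₂ (inj₂ (inj₂ (inj₁ _)))) → ≡.refl
  rows (inj₂ (inj₂ (inj₁ i))) = via O O (⊖ Rev 2) (⊖ J) i (inj₂ (inj₂ (inj₁ i))) λ where
    (inj₁ _)                      → ≡.refl
    (inj₂ (inj₁ _))               → ≡.refl
    (inj₂ (inj₂ (inj₁ j)))        → ⊖Rev₂-entry i j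
    (inj₂ (inj₂ (inj₂ (inj₁ _)))) → ≡.refl
  rows (inj₂ (inj₂ (inj₂ (inj₁ i)))) = via J O (⊖ J) (I _ ⊝ J) i (inj₂ (inj₂ (inj₂ (inj₁ i)))) λ where
    (inj₁ _)                      → ≡.refl
    (inj₂ (inj₁ _))               → ≡.refl
    (inj₂ (inj₂ (inj₁ _)))        → ≡.refl
    (inj₂ (inj₂ (inj₂ (inj₁ j)))) → I⊝J-entry i j

A₁-signed : ∀ m ℓ → IsSignedAdjacency (A₁ m ℓ)
A₁-signed m ℓ = block2-signed (J⊝I-signed m) (⊖-signed (Rev-signed ℓ))

A₂-signed : ∀ m ℓ → IsSignedAdjacency (A₂ m ℓ)
A₂-signed m ℓ = block2-signed (Rev-signed m) (⊖-signed (Rev-signed ℓ))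

A₃-signed : ∀ m ℓ → IsSignedAdjacency (A₃ (suc m) (suc ℓ))
A₃-signed m ℓ = signedAdjacency-pullback (blowup (m ∷ 0 ∷ 0 ∷ ℓ ∷ []) β₃) (Inverse.to (view₄ (suc m) 1 1 (suc ℓ)))
  (A₃-blowup m ℓ) (blowup-signed (m ∷ 0 ∷ 0 ∷ ℓ ∷ []) β₃
    -- Symmetry of the pattern and the range of its values are finite statements about sixteen
    -- entries, settled by evaluation.
    (from-yes (Finₚ.all? λ a → Finₚ.all? λ b → β₃ a b ℤₚ.≟ β₃ b a))
    (from-yes (Finₚ.all? λ a → Finₚ.all? λ b → trit? (β₃ a b))))

A₄-signed : ∀ m ℓ → IsSignedAdjacency (A₄ (suc m) (suc ℓ))
A₄-signed m ℓ = signedAdjacency-pullback (blowup (m ∷ 1 ∷ 1 ∷ ℓ ∷ []) β₄) (Inverse.to (view₄ (suc m) 2 2 (suc ℓ)))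
  (A₄-blowup m ℓ) (blowup-signed (m ∷ 1 ∷ 1 ∷ ℓ ∷ []) β₄
    (from-yes (Finₚ.all? λ a → Finₚ.all? λ b → β₄ a b ℤₚ.≟ β₄ b a))
    (from-yes (Finₚ.all? λ a → Finₚ.all? λ b → trit? (β₄ a b))))

-- Characteristic polynomials and spectra.

module Spectra {c r} (R : CommutativeRing c r) where
  open CommutativeRing R hiding (zero)
  open IntegerSolver R
  open Determinant R
  open ShapedDeterminant R
  open Collapse R
  open import Algebra.Properties.Ring ring using (-‿involutive; -0#≈0#; -1*x≈-x)
  open import Algebra.Properties.Semiring.Exp semiring using (_^_; ^-congˡ; ^-homo-*)
  open import Relation.Binary.Reasoning.Setoid setoid

  sumᴾ : ∀ {v n} → (Fin n → Polynomial v) → Polynomial v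
  sumᴾ {n = zero}  f = con (+ 0)
  sumᴾ {n = suc n} f = f zero :+ sumᴾ (f ∘ suc)

  altSignᴾ : ∀ {v} → ℕ → Polynomial v
  altSignᴾ zero    = con (+ 1)
  altSignᴾ (suc k) = :- altSignᴾ k

  -- Syntactic counterparts of det, δᶠ, fromℕ and fromℤ: their semantics
  -- unfolds to the ring expressions, so the solver applies to them directly.
  detᴾ : ∀ {v n} → (Fin n → Fin n → Polynomial v) → Polynomial v
  detᴾ {n = zero}  M = con (+ 1)
  detᴾ {n = suc n} M =
    sumᴾ (λ j → altSignᴾ (toℕ j) :* (M zero j :* detᴾ (λ i k → M (suc i) (punchIn j k))))

  δᴾ : ∀ {v n} → Fin n → Fin n → Polynomial v
  δᴾ x y = if does (x Finₚ.≟ y) then con (+ 1) else con (+ 0)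

  fromℕᴾ : ∀ {v} → ℕ → Polynomial v
  fromℕᴾ zero    = con (+ 0)
  fromℕᴾ (suc n) = con (+ 1) :+ fromℕᴾ n

  fromℤᴾ : ∀ {v} → ℤ → Polynomial v
  fromℤᴾ (+ n)    = fromℕᴾ n
  fromℤᴾ -[1+ n ] = :- fromℕᴾ (suc n)

  mutual
    charPolyAt≈det : ∀ {n} (A : Matrix n) t →
      charPolyAt R A t ≈ det R (λ i j → t * δᶠ i j - fromℤ R (A i j))
    charPolyAt≈det {n} A t = det-cong {n} λ i j → +-congʳ (diagonal {n} A t i j)

    -- The left-hand side, a function local to charPolyAt that cannot be named
    -- here, is inferred from the use above.
    diagonal : ∀ {n} (A : Matrix n) t i j → _ ≈ t * δᶠ i j
    diagonal A t i j with i Finₚ.≟ j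
    ... | yes _ = sym (*-identityʳ t)
    ... | no _  = sym (zeroʳ t)

  charPolyAt≈DET : ∀ {n} (A : Matrix n) t s (e : Fin n ↔ El s) (N : El s → El s → ℤ) →
    (∀ i j → A i j ≡ N (Inverse.to e i) (Inverse.to e j)) →
    charPolyAt R A t ≈ DET s (λ x y → t * δˢ x y - fromℤ R (N x y))
  charPolyAt≈DET A t s e N A≡N = begin
    charPolyAt R A t
      ≈⟨ charPolyAt≈det A t ⟩
    det R (λ i j → t * δᶠ i j - fromℤ R (A i j))
      ≈⟨ det-cong (λ i j → reflexive (≡.cong₂ (λ d z → t * d - fromℤ R z)
           (≡.sym (δ-injective Finₚ._≟_ _≟ˢ_ to (↔-injective e) i j)) (A≡N i j))) ⟩
    det R (λ i j → t * δˢ (to i) (to j) - fromℤ R (N (to i) (to j)))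
      ≈⟨ det-reindex e (enum s) (λ x y → t * δˢ x y - fromℤ R (N x y)) ⟩
    DET s (λ x y → t * δˢ x y - fromℤ R (N x y)) ∎
    where open Inverse e

  -- Writing the diagonal entry `t` as `(t + β a a) - β a a` turns `t I - A` into a diagonal matrix
  -- constant on blocks plus the block-constant matrix `- β`, which is the form treated by
  -- `DET-blocks`.
  charPolyAt-blowup : ∀ {n k} (A : Matrix n) t (ns : Vec ℕ k) (β : Fin k → Fin k → ℤ) (e : Fin n ↔ El (blocks ns)) →
    (∀ i j → A i j ≡ blowup ns β (Inverse.to e i) (Inverse.to e j)) →
    charPolyAt R A t ≈ powers ns (λ a → t + fromℤ R (β a a)) *
      det R (λ a b → (t + fromℤ R (β a a)) * δᶠ a b + fromℕ R (suc (lookup ns a)) * - fromℤ R (β a b))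
  charPolyAt-blowup {k = k} A t ns β e A≡ = begin
    charPolyAt R A t
      ≈⟨ charPolyAt≈DET A t (blocks ns) e (blowup ns β) A≡ ⟩
    DET (blocks ns) (λ x y → t * δˢ x y - fromℤ R (blowup ns β x y))
      ≈⟨ DET-cong (blocks ns) entry ⟩
    DET (blocks ns) (λ x y → D (blockOf ns x) * δˢ x y + B (blockOf ns x) (blockOf ns y))
      ≈⟨ DET-blocks ns D B ⟩
    powers ns D * det R (λ a b → D a * δᶠ a b + fromℕ R (suc (lookup ns a)) * B a b) ∎
    where
    D : Fin k → Carrier
    D a = t + fromℤ R (β a a)
    B : Mat k
    B a b = - fromℤ R (β a b)
    entry : ∀ x y → t * δˢ x y - fromℤ R (blowup ns β x y) ≈
                    D (blockOf ns x) * δˢ x y + B (blockOf ns x) (blockOf ns y)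
    entry x y with x ≟ˢ y
    ... | yes ≡.refl = solve 2 (λ t b → t :* con (+ 1) :- con (+ 0) := (t :+ b) :* con (+ 1) :+ :- b) refl t _
    ... | no _       = solve 3 (λ t b d → t :* con (+ 0) :- b := d :* con (+ 0) :+ :- b) refl t _ _

  DET-two-blocks : ∀ a b d₀ d₁ k u w →
    DET (fin (suc a) ⊞ fin (suc b))
      (bordered (λ i j → d₀ * δᶠ i j + k) (const u) (const w) (λ i j → d₁ * δᶠ i j)) ≈
    (d₀ ^ a * d₁ ^ b) *
      ((d₀ + fromℕ R (suc a) * k) * d₁ - (fromℕ R (suc a) * u) * (fromℕ R (suc b) * w))
  DET-two-blocks a b d₀ d₁ k u w = begin
    DET (fin (suc a) ⊞ fin (suc b)) M
      ≈⟨ DET-cong (fin (suc a) ⊞ fin (suc b)) entry ⟩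
    DET (fin (suc a) ⊞ fin (suc b)) (λ x y → N (Inverse.to φ x) (Inverse.to φ y))
      ≈⟨ DET-reindex (fin (suc a) ⊞ fin (suc b)) (blocks ns) φ N ⟩
    DET (blocks ns) N
      ≈⟨ DET-blocks ns D B ⟩
    powers ns D * det R (λ x y → D x * δᶠ x y + fromℕ R (suc (lookup ns x)) * B x y)
      -- The quotient of order two is expanded symbolically; the inner `con (+ 1)` is the empty
      -- product that ends `powers`.
      ≈⟨ solve 9 (λ d₀ d₁ k u w P Q A B →
           (P :* (Q :* con (+ 1))) :* detᴾ (λ x y → D₂ d₀ d₁ x :* δᴾ x y :+ D₂ A B x :* M₂ k u w (con (+ 0)) x y) :=
           (P :* Q) :* ((d₀ :+ A :* k) :* d₁ :- (A :* u) :* (B :* w)))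
         refl d₀ d₁ k u w (d₀ ^ a) (d₁ ^ b) (fromℕ R (suc a)) (fromℕ R (suc b)) ⟩
    (d₀ ^ a * d₁ ^ b) *
      ((d₀ + fromℕ R (suc a) * k) * d₁ - (fromℕ R (suc a) * u) * (fromℕ R (suc b) * w)) ∎
    where
    ns : Vec ℕ 2
    ns = a ∷ b ∷ []
    M : El (fin (suc a) ⊞ fin (suc b)) → El (fin (suc a) ⊞ fin (suc b)) → Carrier
    M = bordered (λ i j → d₀ * δᶠ i j + k) (const u) (const w) (λ i j → d₁ * δᶠ i j)
    φ : El (fin (suc a) ⊞ fin (suc b)) ↔ El (blocks ns)
    φ = ⊎-cong ↔-refl ⊎-Fin0
    -- Polymorphic in the entries, so that one definition builds both the matrix over the ring and
    -- its counterpart for the solver.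
    D₂ : ∀ {x} {X : Set x} → X → X → Fin 2 → X
    D₂ p q zero       = p
    D₂ p q (suc zero) = q
    M₂ : ∀ {x} {X : Set x} → X → X → X → X → Fin 2 → Fin 2 → X
    M₂ p q r s zero       = D₂ p q
    M₂ p q r s (suc zero) = D₂ r s
    D = D₂ d₀ d₁
    B = M₂ k u w 0#
    N : El (blocks ns) → El (blocks ns) → Carrier
    N x y = D (blockOf ns x) * δˢ x y + B (blockOf ns x) (blockOf ns y)
    entry : ∀ x y → M x y ≈ N (Inverse.to φ x) (Inverse.to φ y)
    entry (inj₁ i) (inj₁ j) = refl
    entry (inj₁ i) (inj₂ j) = solve 2 (λ d u → u := d :* con (+ 0) :+ u) refl d₀ u
    entry (inj₂ i) (inj₁ j) = solve 2 (λ d u → u := d :* con (+ 0) :+ u) refl d₁ w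
    entry (inj₂ i) (inj₂ j) = sym (+-identityʳ _)

  spectralProduct : Carrier → List Carrier → Carrier
  spectralProduct t μs = List.foldr _*_ 1# (List.map (λ μ → t - μ) μs)

  spectralProduct-^^ : ∀ t μ k μs →
    spectralProduct t (_^^_ R μ k ++ μs) ≈ (t - μ) ^ k * spectralProduct t μs
  spectralProduct-^^ t μ zero    μs = sym (*-identityˡ _)
  spectralProduct-^^ t μ (suc k) μs = trans (*-congˡ (spectralProduct-^^ t μ k μs)) (sym (*-assoc _ _ _))

  spectralProduct-±1 : ∀ t j k μs →
    spectralProduct t (_^^_ R (- 1#) j ++ _^^_ R 1# k ++ μs) ≈
    (t + 1#) ^ j * ((t - 1#) ^ k * spectralProduct t μs)
  spectralProduct-±1 t j k μs = trans
    (spectralProduct-^^ t (- 1#) j (_^^_ R 1# k ++ μs))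
    (*-cong (^-congˡ j (+-congˡ (-‿involutive 1#))) (spectralProduct-^^ t 1# k μs))

  -- A quadratic formula without division: the sum of the roots is `(h + h) * a`, and their product
  -- `h * h * (a * a - s * s)` becomes `(h + h) * (h + h) * k`, since `4 h²` is the square of
  -- `h + h`.
  quadratic-roots : ∀ h s a k t → h + h ≈ 1# → s * s ≈ a * a - fromℕ R 4 * k →
    spectralProduct t (h * (a + s) ∷ h * (a - s) ∷ []) ≈ t * t - a * t + k
  quadratic-roots h s a k t h+h s² = begin
    (t - h * (a + s)) * ((t - h * (a - s)) * 1#)
      ≈⟨ solve 4 (λ h s a t → (t :- h :* (a :+ s)) :* ((t :- h :* (a :- s)) :* con (+ 1)) :=
           t :* t :- (h :+ h) :* a :* t :+ h :* h :* (a :* a :- s :* s)) refl h s a t ⟩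
    t * t - (h + h) * a * t + h * h * (a * a - s * s)
      ≈⟨ +-congˡ (*-congˡ (+-congˡ (-‿cong s²))) ⟩
    t * t - (h + h) * a * t + h * h * (a * a - (a * a - fromℕ R 4 * k))
      ≈⟨ solve 4 (λ h k a t → t :* t :- (h :+ h) :* a :* t :+ h :* h :* (a :* a :- (a :* a :- fromℕᴾ 4 :* k)) :=
           t :* t :- (h :+ h) :* a :* t :+ (h :+ h) :* (h :+ h) :* k) refl h k a t ⟩
    t * t - (h + h) * a * t + (h + h) * (h + h) * k
      ≈⟨ +-cong (+-congˡ (-‿cong (*-congʳ (*-congʳ h+h)))) (*-congʳ (*-cong h+h h+h)) ⟩
    t * t - 1# * a * t + 1# * 1# * k
      ≈⟨ solve 3 (λ k a t → t :* t :- con (+ 1) :* a :* t :+ con (+ 1) :* con (+ 1) :* k :=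
           t :* t :- a :* t :+ k) refl k a t ⟩
    t * t - a * t + k ∎

  quotient₄ : ∀ {v} → (β : Fin 4 → Fin 4 → ℤ) → Polynomial v → Vec (Polynomial v) 4 → Polynomial v
  quotient₄ β t n = detᴾ λ a b → (t :+ fromℤᴾ (β a a)) :* δᴾ a b :+ lookup n a :* :- fromℤᴾ (β a b)

  A₃-spectrum : ∀ m ℓ → HasSpectrum R (A₃ (suc m) (suc ℓ))
    (_^^_ R (- 1#) (suc m) ++ _^^_ R 1# (suc ℓ) ++
      (- fromℕ R (suc ℓ) - 1#) ∷ (fromℕ R (suc m) + 1#) ∷ [])
  A₃-spectrum m ℓ t = begin
    charPolyAt R (A₃ (suc m) (suc ℓ)) t
      ≈⟨ charPolyAt-blowup (A₃ (suc m) (suc ℓ)) t ns β₃ (view₄ (suc m) 1 1 (suc ℓ)) (A₃-blowup m ℓ) ⟩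
    -- The factors `1#` after `P` are zeroth powers: a singleton block has no extras.
    (P * (1# * (1# * (Q * 1#)))) *
      det R (λ a b → (t + fromℤ R (β₃ a a)) * δᶠ a b + fromℕ R (suc (lookup ns a)) * - fromℤ R (β₃ a b))
      ≈⟨ *-cong (*-cong (^-congˡ m (+-congˡ fromℤ-1)) (*-congˡ (*-congˡ (*-congʳ (^-congˡ ℓ (+-congˡ (-‿cong fromℤ-1)))))))
           (quotient-det t (fromℕ R m) (fromℕ R ℓ)) ⟩
    ((t + 1#) ^ m * (1# * (1# * ((t - 1#) ^ ℓ * 1#)))) *
      ((t + 1#) * ((t - 1#) * ((t - (- (1# + fromℕ R ℓ) - 1#)) * ((t - (1# + fromℕ R m + 1#)) * 1#))))
      ≈⟨ solve 5 (λ x p y q z → (p :* (con (+ 1) :* (con (+ 1) :* (q :* con (+ 1))))) :* (x :* (y :* z)) :=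
                   (x :* p) :* ((y :* q) :* z)) refl (t + 1#) ((t + 1#) ^ m) (t - 1#) ((t - 1#) ^ ℓ) _ ⟩
    (t + 1#) ^ suc m * ((t - 1#) ^ suc ℓ * spectralProduct t μs)
      ≈⟨ spectralProduct-±1 t (suc m) (suc ℓ) μs ⟨
    spectralProduct t (_^^_ R (- 1#) (suc m) ++ _^^_ R 1# (suc ℓ) ++ μs) ∎
    where
    ns : Vec ℕ 4
    ns = m ∷ 0 ∷ 0 ∷ ℓ ∷ []
    μs : List Carrier
    μs = (- fromℕ R (suc ℓ) - 1#) ∷ (fromℕ R (suc m) + 1#) ∷ []
    P = (t + fromℤ R (+ 1)) ^ m
    Q = (t + fromℤ R -[1+ 0 ]) ^ ℓ
    -- The quotient itself has the roots -1 and 1, which raise the exponents `m` and `ℓ` to the full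
    -- block sizes. The other two roots are integral, so neither `h` nor `s` is required.
    quotient-det = solve 3 (λ t m ℓ →
      quotient₄ β₃ t ((con (+ 1) :+ m) ∷ fromℕᴾ 1 ∷ fromℕᴾ 1 ∷ (con (+ 1) :+ ℓ) ∷ []) :=
      (t :+ con (+ 1)) :* ((t :- con (+ 1)) :* ((t :- (:- (con (+ 1) :+ ℓ) :- con (+ 1))) :*
        ((t :- (con (+ 1) :+ m :+ con (+ 1))) :* con (+ 1))))) refl

  A₄-spectrum : ∀ m ℓ h s → h + h ≈ 1# → let M = suc m; L = suc ℓ in
    s * s ≈ fromℕ R (M ℕ.* M ℕ.+ L ℕ.* L ℕ.+ 6 ℕ.* M ℕ.* L ℕ.+ 4 ℕ.* M ℕ.+ 4 ℕ.* L ℕ.+ 4) →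
    HasSpectrum R (A₄ M L)
      (_^^_ R (- 1#) (M ℕ.+ 1) ++ _^^_ R 1# (L ℕ.+ 1) ++
        (h * ((fromℕ R M - fromℕ R L) + s)) ∷ (h * ((fromℕ R M - fromℕ R L) - s)) ∷ [])
  A₄-spectrum m ℓ h s h+h s² t = begin
    charPolyAt R (A₄ M L) t
      ≈⟨ charPolyAt-blowup (A₄ M L) t ns β₄ (view₄ M 2 2 L) (A₄-blowup m ℓ) ⟩
    (p ^ m * (p * 1# * (q * 1# * (q ^ ℓ * 1#)))) *
      det R (λ a b → (t + fromℤ R (β₄ a a)) * δᶠ a b + fromℕ R (suc (lookup ns a)) * - fromℤ R (β₄ a b))
      ≈⟨ *-cong (*-cong (^-congˡ m p≈) (*-cong (*-congʳ p≈) (*-cong (*-congʳ q≈) (*-congʳ (^-congˡ ℓ q≈)))))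
           (quotient-det t (fromℕ R M) (fromℕ R L)) ⟩
    ((t + 1#) ^ m * ((t + 1#) * 1# * ((t - 1#) * 1# * ((t - 1#) ^ ℓ * 1#)))) *
      ((t + 1#) * ((t - 1#) * (t * t - a * t + k)))
      ≈⟨ solve 5 (λ x p y q z →
           (p :* (x :* con (+ 1) :* (y :* con (+ 1) :* (q :* con (+ 1))))) :* (x :* (y :* z)) :=
           (x :* (p :* (x :* con (+ 1)))) :* ((y :* (q :* (y :* con (+ 1)))) :* z))
           refl (t + 1#) ((t + 1#) ^ m) (t - 1#) ((t - 1#) ^ ℓ) _ ⟩
    ((t + 1#) * ((t + 1#) ^ m * (t + 1#) ^ 1)) * (((t - 1#) * ((t - 1#) ^ ℓ * (t - 1#) ^ 1)) * (t * t - a * t + k))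
      ≈⟨ *-cong (*-congˡ (^-homo-* (t + 1#) m 1))
           (*-cong (*-congˡ (^-homo-* (t - 1#) ℓ 1)) (quadratic-roots h s a k t h+h discriminant)) ⟨
    (t + 1#) ^ (M ℕ.+ 1) * ((t - 1#) ^ (L ℕ.+ 1) * spectralProduct t μs)
      ≈⟨ spectralProduct-±1 t (M ℕ.+ 1) (L ℕ.+ 1) μs ⟨
    spectralProduct t (_^^_ R (- 1#) (M ℕ.+ 1) ++ _^^_ R 1# (L ℕ.+ 1) ++ μs) ∎
    where
    M L : ℕ
    M = suc m
    L = suc ℓ
    ns : Vec ℕ 4
    ns = m ∷ 1 ∷ 1 ∷ ℓ ∷ []
    p = t + fromℤ R (+ 1)
    q = t + fromℤ R -[1+ 0 ]
    p≈ : p ≈ t + 1#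
    p≈ = +-congˡ fromℤ-1
    q≈ : q ≈ t - 1#
    q≈ = +-congˡ (-‿cong fromℤ-1)
    a = fromℕ R M - fromℕ R L
    -- Constant term of the quadratic factor left after the quotient has given up `(t + 1) (t - 1)`.
    -- With it `a² - 4 k` is the radicand of the statement.
    k = - (fromℕ R 2 * fromℕ R M * fromℕ R L + fromℕ R M + fromℕ R L + 1#)
    μs : List Carrier
    μs = h * (a + s) ∷ h * (a - s) ∷ []
    quotient-det = solve 3 (λ t m ℓ →
      quotient₄ β₄ t (m ∷ fromℕᴾ 2 ∷ fromℕᴾ 2 ∷ ℓ ∷ []) :=
      (t :+ con (+ 1)) :* ((t :- con (+ 1)) :*
        (t :* t :- (m :- ℓ) :* t :+ :- (fromℕᴾ 2 :* m :* ℓ :+ m :+ ℓ :+ con (+ 1))))) refl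
    discriminant : s * s ≈ a * a - fromℕ R 4 * k
    discriminant = begin
      s * s
        ≈⟨ s² ⟩
      fromℕ R (M ℕ.* M ℕ.+ L ℕ.* L ℕ.+ 6 ℕ.* M ℕ.* L ℕ.+ 4 ℕ.* M ℕ.+ 4 ℕ.* L ℕ.+ 4)
        ≈⟨ trans (fromℕ-+ (M ℕ.* M ℕ.+ L ℕ.* L ℕ.+ 6 ℕ.* M ℕ.* L ℕ.+ 4 ℕ.* M ℕ.+ 4 ℕ.* L) 4) (+-congʳ
           (trans (fromℕ-+ (M ℕ.* M ℕ.+ L ℕ.* L ℕ.+ 6 ℕ.* M ℕ.* L ℕ.+ 4 ℕ.* M) (4 ℕ.* L)) (+-cong
           (trans (fromℕ-+ (M ℕ.* M ℕ.+ L ℕ.* L ℕ.+ 6 ℕ.* M ℕ.* L) (4 ℕ.* M)) (+-cong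
           (trans (fromℕ-+ (M ℕ.* M ℕ.+ L ℕ.* L) (6 ℕ.* M ℕ.* L)) (+-cong
           (trans (fromℕ-+ (M ℕ.* M) (L ℕ.* L)) (+-cong (fromℕ-* M M) (fromℕ-* L L)))
           (trans (fromℕ-* (6 ℕ.* M) L) (*-congʳ (fromℕ-* 6 M)))))
           (fromℕ-* 4 M)))
           (fromℕ-* 4 L)))) ⟩
      fromℕ R M * fromℕ R M + fromℕ R L * fromℕ R L + fromℕ R 6 * fromℕ R M * fromℕ R L
        + fromℕ R 4 * fromℕ R M + fromℕ R 4 * fromℕ R L + fromℕ R 4
        ≈⟨ solve 2 (λ m ℓ →
             m :* m :+ ℓ :* ℓ :+ fromℕᴾ 6 :* m :* ℓ :+ fromℕᴾ 4 :* m :+ fromℕᴾ 4 :* ℓ :+ fromℕᴾ 4 :=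
             (m :- ℓ) :* (m :- ℓ) :- fromℕᴾ 4 :* :- (fromℕᴾ 2 :* m :* ℓ :+ m :+ ℓ :+ con (+ 1)))
             refl (fromℕ R M) (fromℕ R L) ⟩
      a * a - fromℕ R 4 * k ∎

  fromℤ-neg : ∀ z → fromℤ R (ℤ.- z) ≈ - fromℤ R z
  fromℤ-neg (+ zero)  = sym -0#≈0#
  fromℤ-neg (+ suc n) = refl
  fromℤ-neg -[1+ n ]  = sym (-‿involutive _)

  t*0-1 : ∀ t → t * 0# - fromℤ R (+ 1) ≈ - 1#
  t*0-1 = solve 1 (λ t → t :* con (+ 0) :- fromℤᴾ (+ 1) := :- con (+ 1)) refl

  -- The step shared by `A₁` and `A₂`: the lower block of `t I - A` is `t I + R`, so `DET-rev`
  -- applies with `p = t` and `q = 1`.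
  charPolyAt-⊖Rev : ∀ {n} (A : Matrix n) ℓ t →
    charPolyAt R (block2 A J J (⊖ Rev (2 ℕ.* ℓ))) t ≈
    (t - 1#) ^ ℓ * DET (fin n ⊞ fin ℓ)
      (bordered (λ i j → t * δᶠ i j - fromℤ R (A i j)) (const (- 1#)) (const (- 1# + - 1#)) (λ i j → (t + 1#) * δᶠ i j))
  charPolyAt-⊖Rev {n} A ℓ t = begin
    charPolyAt R (block2 A J J D) t
      ≈⟨ charPolyAt≈DET (block2 A J J D) t s Finₚ.+↔⊎ (joined A D) (block2-joined A D) ⟩
    DET s (λ x y → t * δˢ {s} x y - fromℤ R (joined A D x y))
      ≈⟨ DET-cong s entry ⟩
    DET s (bordered X (const (- 1#)) (const (- 1#)) Y)
      ≈⟨ DET-rev (fin n) ℓ X (const (- 1#)) (const (- 1#)) t 1# ⟩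
    (t - 1#) ^ ℓ * DET (fin n ⊞ fin ℓ) (bordered X (const (- 1#)) (const (- 1# + - 1#)) (λ i j → (t + 1#) * δᶠ i j)) ∎
    where
    D = ⊖ Rev (2 ℕ.* ℓ)
    s = fin n ⊞ fin (2 ℕ.* ℓ)
    X : Mat n
    X i j = t * δᶠ i j - fromℤ R (A i j)
    Y : Mat (2 ℕ.* ℓ)
    Y i j = t * δᶠ i j + 1# * rev (2 ℕ.* ℓ) i j
    entry : ∀ x y → t * δˢ {s} x y - fromℤ R (joined A D x y) ≈ bordered X (const (- 1#)) (const (- 1#)) Y x y
    entry (inj₁ i) (inj₁ j) = refl
    entry (inj₁ _) (inj₂ _) = t*0-1 t
    entry (inj₂ _) (inj₁ _) = t*0-1 t
    entry (inj₂ i) (inj₂ j) = +-congˡ (begin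
      - fromℤ R (ℤ.- Rev (2 ℕ.* ℓ) i j)  ≈⟨ -‿cong (fromℤ-neg (Rev (2 ℕ.* ℓ) i j)) ⟩
      - - rev (2 ℕ.* ℓ) i j              ≈⟨ -‿involutive _ ⟩
      rev (2 ℕ.* ℓ) i j                  ≈⟨ *-identityˡ _ ⟨
      1# * rev (2 ℕ.* ℓ) i j             ∎)

  bordered-cong : ∀ {S T : Set} {X X′ : S → S → Carrier} {u w : S → Carrier} {Y : T → T → Carrier} →
    (∀ x y → X x y ≈ X′ x y) → ∀ x y → bordered X u w Y x y ≈ bordered X′ u w Y x y
  bordered-cong X≈ (inj₁ x) (inj₁ y) = X≈ x y
  bordered-cong X≈ (inj₁ _) (inj₂ _) = refl
  bordered-cong X≈ (inj₂ _) (inj₁ _) = refl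
  bordered-cong X≈ (inj₂ _) (inj₂ _) = refl

  A₁-spectrum : ∀ m ℓ h s → h + h ≈ 1# → let M = suc m; L = suc ℓ in
    s * s ≈ fromℕ R (M ℕ.* (M ℕ.+ 8 ℕ.* L)) →
    HasSpectrum R (A₁ M L)
      (_^^_ R (- 1#) (L ℕ.+ M ∸ 2) ++ _^^_ R 1# L ++
        (h * ((fromℕ R M - fromℕ R 2) + s)) ∷ (h * ((fromℕ R M - fromℕ R 2) - s)) ∷ [])
  A₁-spectrum m ℓ h s h+h s² t = begin
    charPolyAt R (A₁ M L) t
      ≈⟨ charPolyAt-⊖Rev (J ⊝ I M) L t ⟩
    (t - 1#) ^ L * DET (fin M ⊞ fin L)
      (bordered (λ i j → t * δᶠ i j - fromℤ R ((J ⊝ I M) i j)) (const (- 1#)) (const (- 1# + - 1#)) (λ i j → (t + 1#) * δᶠ i j))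
      ≈⟨ *-congˡ (DET-cong (fin M ⊞ fin L) (bordered-cong entry)) ⟩
    (t - 1#) ^ L * DET (fin M ⊞ fin L)
      (bordered (λ i j → (t + 1#) * δᶠ i j + - 1#) (const (- 1#)) (const (- 1# + - 1#)) (λ i j → (t + 1#) * δᶠ i j))
      ≈⟨ *-congˡ (DET-two-blocks m ℓ (t + 1#) (t + 1#) (- 1#) (- 1#) (- 1# + - 1#)) ⟩
    (t - 1#) ^ L * (((t + 1#) ^ m * (t + 1#) ^ ℓ) *
      ((t + 1# + fromℕ R M * - 1#) * (t + 1#) - (fromℕ R M * - 1#) * (fromℕ R L * (- 1# + - 1#))))
      ≈⟨ solve 6 (λ t m ℓ P Q S →
           S :* ((P :* Q) :* ((t :+ con (+ 1) :+ m :* :- con (+ 1)) :* (t :+ con (+ 1)) :-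
             (m :* :- con (+ 1)) :* (ℓ :* (:- con (+ 1) :+ :- con (+ 1))))) :=
           (Q :* P) :* (S :* (t :* t :- (m :- fromℕᴾ 2) :* t :+ (con (+ 1) :- m :- fromℕᴾ 2 :* ℓ :* m))))
           refl t (fromℕ R M) (fromℕ R L) ((t + 1#) ^ m) ((t + 1#) ^ ℓ) ((t - 1#) ^ L) ⟩
    ((t + 1#) ^ ℓ * (t + 1#) ^ m) * ((t - 1#) ^ L * (t * t - a * t + k))
      ≈⟨ *-cong (^-homo-* (t + 1#) ℓ m) (*-congˡ (quadratic-roots h s a k t h+h discriminant)) ⟨
    (t + 1#) ^ (ℓ ℕ.+ m) * ((t - 1#) ^ L * spectralProduct t μs)
      -- Here `L + M ∸ 2` reduces only to `(ℓ + suc m) ∸ 1`; the successor has to be moved outward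
      -- before the last subtraction computes.
      ≡⟨ ≡.cong (λ n → (t + 1#) ^ (n ∸ 1) * ((t - 1#) ^ L * spectralProduct t μs)) (ℕₚ.+-suc ℓ m) ⟨
    (t + 1#) ^ (L ℕ.+ M ∸ 2) * ((t - 1#) ^ L * spectralProduct t μs)
      ≈⟨ spectralProduct-±1 t (L ℕ.+ M ∸ 2) L μs ⟨
    spectralProduct t (_^^_ R (- 1#) (L ℕ.+ M ∸ 2) ++ _^^_ R 1# L ++ μs) ∎
    where
    M L : ℕ
    M = suc m
    L = suc ℓ
    -- For block sizes `M` and `L`, the quotient determinant `(t + 1 - M) (t + 1) - 2 M L` equals
    -- `t² - a t + k`.
    a = fromℕ R M - fromℕ R 2
    k = 1# - fromℕ R M - fromℕ R 2 * fromℕ R L * fromℕ R M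
    μs : List Carrier
    μs = h * (a + s) ∷ h * (a - s) ∷ []
    entry : ∀ i j → t * δᶠ i j - fromℤ R ((J ⊝ I M) i j) ≈ (t + 1#) * δᶠ i j + - 1#
    entry i j with i Finₚ.≟ j
    ... | yes _ = solve 1 (λ t → t :* con (+ 1) :- con (+ 0) := (t :+ con (+ 1)) :* con (+ 1) :+ :- con (+ 1)) refl t
    ... | no _  = solve 1 (λ t → t :* con (+ 0) :- fromℕᴾ 1 := (t :+ con (+ 1)) :* con (+ 0) :+ :- con (+ 1)) refl t
    discriminant : s * s ≈ a * a - fromℕ R 4 * k
    discriminant = begin
      s * s
        ≈⟨ s² ⟩
      fromℕ R (M ℕ.* (M ℕ.+ 8 ℕ.* L))
        ≈⟨ trans (fromℕ-* M (M ℕ.+ 8 ℕ.* L)) (*-congˡ (trans (fromℕ-+ M (8 ℕ.* L)) (+-congˡ (fromℕ-* 8 L)))) ⟩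
      fromℕ R M * (fromℕ R M + fromℕ R 8 * fromℕ R L)
        ≈⟨ solve 2 (λ m ℓ → m :* (m :+ fromℕᴾ 8 :* ℓ) :=
             (m :- fromℕᴾ 2) :* (m :- fromℕᴾ 2) :- fromℕᴾ 4 :* (con (+ 1) :- m :- fromℕᴾ 2 :* ℓ :* m))
             refl (fromℕ R M) (fromℕ R L) ⟩
      a * a - fromℕ R 4 * k ∎

  A₂-spectrum : ∀ m ℓ s → let M = suc m; L = suc ℓ in
    s * s ≈ fromℕ R (1 ℕ.+ 4 ℕ.* M ℕ.* L) →
    HasSpectrum R (A₂ M L) (_^^_ R (- 1#) (M ℕ.+ L ∸ 1) ++ _^^_ R 1# (M ℕ.+ L ∸ 1) ++ s ∷ (- s) ∷ [])
  A₂-spectrum m ℓ s s² t = begin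
    charPolyAt R (A₂ M L) t
      ≈⟨ charPolyAt-⊖Rev (Rev (2 ℕ.* M)) L t ⟩
    (t - 1#) ^ L * DET (fin (2 ℕ.* M) ⊞ fin L)
      (bordered (λ i j → t * δᶠ i j - rev (2 ℕ.* M) i j) (const (- 1#)) (const (- 1# + - 1#)) Y)
      ≈⟨ *-congˡ (DET-cong (fin (2 ℕ.* M) ⊞ fin L) (bordered-cong λ i j → +-congˡ (sym (-1*x≈-x (rev (2 ℕ.* M) i j))))) ⟩
    (t - 1#) ^ L * DET (fin (2 ℕ.* M) ⊞ fin L) N
      -- `DET-rev` collapses the second summand, so the blocks change places before the mirror pairs
      -- of `R` in the other block are merged.
      ≈⟨ *-congˡ (DET-reindex (fin L ⊞ fin (2 ℕ.* M)) (fin (2 ℕ.* M) ⊞ fin L) (⊎-comm _ _) N) ⟨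
    (t - 1#) ^ L * DET (fin L ⊞ fin (2 ℕ.* M)) (λ x y → N (Sum.swap x) (Sum.swap y))
      ≈⟨ *-congˡ (DET-cong (fin L ⊞ fin (2 ℕ.* M)) swapped) ⟩
    (t - 1#) ^ L * DET (fin L ⊞ fin (2 ℕ.* M)) (bordered Y′ (const (- 1# + - 1#)) (const (- 1#)) X)
      ≈⟨ *-congˡ (DET-rev (fin L) M Y′ (const (- 1# + - 1#)) (const (- 1#)) t (- 1#)) ⟩
    (t - 1#) ^ L * ((t - - 1#) ^ M * DET (fin L ⊞ fin M)
      (bordered Y′ (const (- 1# + - 1#)) (const (- 1# + - 1#)) (λ i j → (t + - 1#) * δᶠ i j)))
      ≈⟨ *-congˡ (*-cong (^-congˡ M (+-congˡ (-‿involutive 1#)))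
           (DET-two-blocks ℓ m (t + 1#) (t - 1#) 0# (- 1# + - 1#) (- 1# + - 1#))) ⟩
    (t - 1#) ^ L * ((t + 1#) ^ M * (((t + 1#) ^ ℓ * (t - 1#) ^ m) *
      ((t + 1# + fromℕ R L * 0#) * (t - 1#) - (fromℕ R L * (- 1# + - 1#)) * (fromℕ R M * (- 1# + - 1#)))))
      -- The block of order `2 L` supplies `(t - 1)^L (t + 1)^ℓ` and the block of order `2 M`
      -- supplies `(t + 1)^M (t - 1)^m`, so both exponents total `M + L - 1`. The doubled borders of
      -- both sides multiply to `4 M L`.
      ≈⟨ solve 7 (λ t m ℓ p q x y →
           ((t :- con (+ 1)) :* q) :* (((t :+ con (+ 1)) :* x) :* ((y :* p) :*
             ((t :+ con (+ 1) :+ ℓ :* con (+ 0)) :* (t :- con (+ 1)) :-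
              (ℓ :* (:- con (+ 1) :+ :- con (+ 1))) :* (m :* (:- con (+ 1) :+ :- con (+ 1)))))) :=
           (x :* ((t :+ con (+ 1)) :* y)) :* ((p :* ((t :- con (+ 1)) :* q)) :*
             (t :* t :- (con (+ 1) :+ fromℕᴾ 4 :* m :* ℓ))))
           refl t (fromℕ R M) (fromℕ R L) ((t - 1#) ^ m) ((t - 1#) ^ ℓ) ((t + 1#) ^ m) ((t + 1#) ^ ℓ) ⟩
    ((t + 1#) ^ m * (t + 1#) ^ L) * (((t - 1#) ^ m * (t - 1#) ^ L) *
      (t * t - (1# + fromℕ R 4 * fromℕ R M * fromℕ R L)))
      ≈⟨ *-cong (^-homo-* (t + 1#) m L) (*-cong (^-homo-* (t - 1#) m L) roots) ⟨
    (t + 1#) ^ (m ℕ.+ L) * ((t - 1#) ^ (m ℕ.+ L) * spectralProduct t (s ∷ - s ∷ []))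
      ≈⟨ spectralProduct-±1 t (m ℕ.+ L) (m ℕ.+ L) (s ∷ - s ∷ []) ⟨
    spectralProduct t (_^^_ R (- 1#) (m ℕ.+ L) ++ _^^_ R 1# (m ℕ.+ L) ++ s ∷ - s ∷ []) ∎
    where
    M L : ℕ
    M = suc m
    L = suc ℓ
    X : Mat (2 ℕ.* M)
    X i j = t * δᶠ i j + - 1# * rev (2 ℕ.* M) i j
    Y Y′ : Mat L
    Y  i j = (t + 1#) * δᶠ i j
    -- The added zero is the constant `k` in the form expected by `DET-two-blocks`.
    Y′ i j = (t + 1#) * δᶠ i j + 0#
    N : El (fin (2 ℕ.* M) ⊞ fin L) → El (fin (2 ℕ.* M) ⊞ fin L) → Carrier
    N = bordered X (const (- 1#)) (const (- 1# + - 1#)) Y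
    swapped : ∀ x y → N (Sum.swap x) (Sum.swap y) ≈ bordered Y′ (const (- 1# + - 1#)) (const (- 1#)) X x y
    swapped (inj₁ _) (inj₁ _) = sym (+-identityʳ _)
    swapped (inj₁ _) (inj₂ _) = refl
    swapped (inj₂ _) (inj₁ _) = refl
    swapped (inj₂ _) (inj₂ _) = refl
    roots : spectralProduct t (s ∷ - s ∷ []) ≈ t * t - (1# + fromℕ R 4 * fromℕ R M * fromℕ R L)
    roots = begin
      (t - s) * ((t - - s) * 1#)
        ≈⟨ solve 2 (λ t s → (t :- s) :* ((t :- :- s) :* con (+ 1)) := t :* t :- s :* s) refl t s ⟩
      t * t - s * s
        ≈⟨ +-congˡ (-‿cong (trans s² (+-congˡ
             (trans (fromℕ-* (4 ℕ.* M) L) (*-congʳ (fromℕ-* 4 M)))))) ⟩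
      t * t - (1# + fromℕ R 4 * fromℕ R M * fromℕ R L) ∎

theorem5p1 : ∀ {c r} (R : CommutativeRing c r) (m ℓ : ℕ) → 1 ≤ m → 1 ≤ ℓ →
    let open CommutativeRing R in
    (IsSignedAdjacency (A₁ m ℓ) ×
    ((h s : Carrier) → h + h ≈ 1# → s * s ≈ fromℕ R (m ℕ.* (m ℕ.+ 8 ℕ.* ℓ)) →
    HasSpectrum R (A₁ m ℓ)
    (_^^_ R (- 1#) (ℓ ℕ.+ m ∸ 2) ++ _^^_ R 1# ℓ ++
    (h * ((fromℕ R m - fromℕ R 2) + s)) ∷
    (h * ((fromℕ R m - fromℕ R 2) - s)) ∷ []))) ×
    (IsSignedAdjacency (A₂ m ℓ) ×
    ((s : Carrier) → s * s ≈ fromℕ R (1 ℕ.+ 4 ℕ.* m ℕ.* ℓ) →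
    HasSpectrum R (A₂ m ℓ)
    (_^^_ R (- 1#) (m ℕ.+ ℓ ∸ 1) ++ _^^_ R 1# (m ℕ.+ ℓ ∸ 1) ++
    s ∷ (- s) ∷ []))) ×
    (IsSignedAdjacency (A₃ m ℓ) ×
    HasSpectrum R (A₃ m ℓ)
    (_^^_ R (- 1#) m ++ _^^_ R 1# ℓ ++
    (- fromℕ R ℓ - 1#) ∷ (fromℕ R m + 1#) ∷ [])) ×
    (IsSignedAdjacency (A₄ m ℓ) ×
    ((h s : Carrier) → h + h ≈ 1# →
    s * s ≈ fromℕ R (m ℕ.* m ℕ.+ ℓ ℕ.* ℓ ℕ.+ 6 ℕ.* m ℕ.* ℓ ℕ.+ 4 ℕ.* m ℕ.+ 4 ℕ.* ℓ ℕ.+ 4) →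
    HasSpectrum R (A₄ m ℓ)
    (_^^_ R (- 1#) (m ℕ.+ 1) ++ _^^_ R 1# (ℓ ℕ.+ 1) ++
    (h * ((fromℕ R m - fromℕ R ℓ) + s)) ∷
    (h * ((fromℕ R m - fromℕ R ℓ) - s)) ∷ [])))
theorem5p1 R (suc m) (suc ℓ) _ _ =
  (A₁-signed (suc m) (suc ℓ) , A₁-spectrum m ℓ) ,
  (A₂-signed (suc m) (suc ℓ) , A₂-spectrum m ℓ) ,
  (A₃-signed m ℓ , A₃-spectrum m ℓ) ,
  (A₄-signed m ℓ , A₄-spectrum m ℓ)
  where open Spectra R
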